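{- Let $Q$ be the cube graph. Every biminimal pot that $3$-realizes $Q$, i.e. every pot $P$ that $3$-realizes $Q$ with $|P|=T_3(Q)$ and $|\Sigma(P)|=B_3(Q)$, is isomorphic (as a pot) to one of the following two pots: (i) $P_1=\big\{\{1,1,1\},\{2,2,2\},\{ -2,-3,-3\},\{ -1,-4,-4\},\{ -1,3,-5\},\{ -2,4,5\}\big\}$; (ii) $P_2=\big\{\{1,1,1\},\{2,2,2\},\{ -2,-3,-3\},\{ -1,-4,-4\},\{3,4,5\},\{ -1,-2,-5\}\big\}$. (Here the inner braces denote multisets.)
   Context: Graphs are connected, have non-empty vertex set, and may have loops and multiple edges. Formally a graph is a triple $(V(G),E(G),\mu)$ with $\mu$ assigning to each edge an unordered pair of (not necessarily distinct) vertices (undirected graph) or an ordered pair of vertices (directed graph). An orientation $\vec G$ of an undirected graph $G$ is a directed graph obtained by choosing a direction for every edge of $G$. The cube $Q$ is the simple undirected graph with vertex set $\mathbb{Z}_2^3$ in which $x,y$ are adjacent iff $x-y\in\{100,010,001\}$. An edge-coloring of a graph with $c$ colors is any map $\lambda$ from its edge set to $[1,c]=\{1,\dots,c\}$ (no properness required). A tile is a finite multiset of integers; a pot is a set of tiles. $\Sigma(P)$ is the set of positive integers (colors) appearing in some tile of the pot $P$. For an edge-coloring $\lambda$ of a directed graph $D$ and a vertex $x$, the tile $\tau_x(\lambda)$ is the multiset containing one copy of $\lambda(e)$ for each non-loop edge $e$ with tail $x$ (i.e. $e=(x,y)$, $y\ne x$), one copy of $-\lambda(e)$ for each non-loop edge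 $e$ with head $x$ (i.e. $e=(y,x)$, $y\neq x$), and both $\lambda(e)$ and $-\lambda(e)$ for each loop $e$ at $x$. The pot induced by $\lambda$ is $\mathcal{P}(\lambda)=\{\tau_x(\lambda)\mid x\in V(D)\}$ (a set of distinct tiles). A pot $P$ realizes an undirected graph $G$, written $G\in\mathcal{O}(P)$, if there is an edge-coloring $\lambda$ of some orientation of $G$ with $\mathcal{P}(\lambda)\subseteq P$ (such $\lambda$ is a realization of $G$ through $P$). $P$ $3$-realizes $G$ if $G\in\mathcal{O}(P)$ and there is no $H\in\mathcal{O}(P)$ with $H\not\simeq G$ and $|V(H)|\le|V(G)|$. $T_3(G)=\min\{|P| : P \text{ is a pot that 3-realizes } G\}$ and $B_3(G)=\min\{|\Sigma(P)| : P \text{ is a pot that 3-realizes } G\}$ (two independent minima). A pot $P$ that $3$-realizes $G$ is biminimal if $|P|=T_3(G)$ and $|\Sigma(P)|=B_3(G)$. Two pots $P,P'$ are isomorphic if there is a bijection $f:\pm\Sigma(P)\to\pm\Sigma(P')$, where $\pm X=X\cup(-X)$, with $f(-i)=-f(i)$ for all $i$ and $f(P)=P'$, where $f$ is applied elementwise (with multiplicity) to tiles and to each tile of a pot. -}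

module Defs where

open import Data.Bool.Base using (if_then_else_)
open import Data.Fin using (#_)
open import Data.Fin.Base using (Fin; toℕ; finToFun)
open import Data.Fin.Patterns using (0F; 1F; 2F; 3F; 4F; 5F; 6F; 7F)
import Data.Fin.Properties as Fin
open import Data.Integer.Base using (ℤ; +_; -_; +[1+_]; 0ℤ)
import Data.Integer.Base as ℤ
open import Data.List.Base
  using (List; []; _∷_; _++_; [_]; length; lookup; map; concatMap; filter;
         cartesianProduct; allFin)
open import Data.List.Membership.Propositional using (_∈_)
import Data.List.Membership.Setoid as SetoidMembership
open import Data.List.Relation.Binary.Permutation.Propositional
  using (_↭_; ↭-setoid; ↭-sym; ↭-trans)
open import Data.List.Relation.Unary.All using (All)
open import Data.List.Relation.Unary.Any using (Any)
import Data.List.Relation.Unary.Any as Any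
open import Data.List.Relation.Unary.Unique.Setoid using (Unique)
open import Data.Nat.Base using (ℕ; _+_; _∸_; _≤_; _<_; _^_; z≤n; s≤s)
open import Data.Nat.DivMod using (_mod_)
open import Data.Product.Base using (Σ; ∃; _×_; _,_; proj₁; proj₂; map₂; swap)
import Data.Product.Base as Product
open import Data.Sum.Base using (_⊎_; inj₂)
import Data.Sum.Base as Sum
import Data.Vec.Base as Vec
open Vec using ([]; _∷_)
open import Function.Base using (_∘_)
open import Function.Bundles using (_⇔_; _↔_; Inverse)
open import Relation.Binary.Bundles using (Setoid)
open import Relation.Binary.Construct.Closure.ReflexiveTransitive
  using (Star; ε; _◅_; _◅◅_; reverse)
open import Relation.Binary.PropositionalEquality using (_≡_; refl; setoid; subst)
open import Relation.Nullary.Decidable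
  using (Dec; does; from-yes; _×-dec_)
open import Relation.Nullary.Negation using (¬_)

infix 4 _∼_

-- Equality of unordered pairs.
_∼_ : {A : Set} → A × A → A × A → Set
p ∼ q = p ≡ q ⊎ p ≡ swap q

Adjacent : ∀ {n m} → (Fin m → Fin n × Fin n) → Fin n → Fin n → Set
Adjacent ends x y = ∃ λ e → ends e ∼ (x , y)

-- A finite undirected multigraph; ends e is read up to _∼_.
record Graph : Set where
  field
    #V #E     : ℕ
    ends      : Fin #E → Fin #V × Fin #V
    nonEmpty  : 0 < #V
    connected : ∀ x y → Star (Adjacent ends) x y

open Graph public

infix 4 _≃_

record _≃_ (G H : Graph) : Set where
  field
    onV       : Fin (#V G) ↔ Fin (#V H)
    onE       : Fin (#E G) ↔ Fin (#E H)
    incidence : ∀ e → ends H (Inverse.to onE e)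
                    ∼ Product.map (Inverse.to onV) (Inverse.to onV) (ends G e)

-- The arcs (tail , head) of a directed graph on the vertices and edges of G
-- that has G as its underlying undirected graph.
record Orientation (G : Graph) : Set where
  field
    arc     : Fin (#E G) → Fin (#V G) × Fin (#V G)
    orients : ∀ e → arc e ∼ ends G e

  tail head : Fin (#E G) → Fin (#V G)
  tail = proj₁ ∘ arc
  head = proj₂ ∘ arc

-- Finite multisets of integers: lists, always compared by _↭_.
Tile : Set
Tile = List ℤ

infix 4 _⊆ₚ_

-- resp makes _∋_ a predicate on multisets.  Pots need not be finite.
record Pot : Set₁ where
  infix 4 _∋_
  field
    _∋_  : Tile → Set
    resp : ∀ {t u} → t ↭ u → _∋_ t → _∋_ u

open Pot public using (_∋_)

_⊆ₚ_ : Pot → Pot → Set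
P ⊆ₚ P′ = ∀ t → P ∋ t → P′ ∋ t

pot : List Tile → Pot
pot ts = record
  { _∋_  = λ t → Any (t ↭_) ts
  ; resp = λ t↭u → Any.map (↭-trans (↭-sym t↭u))
  }

-- The set usually written Σ(P).
Colors : Pot → ℤ → Set
Colors P i = 0ℤ ℤ.< i × ∃ λ t → P ∋ t × i ∈ t

±_ : (ℤ → Set) → (ℤ → Set)
(± X) i = X i ⊎ X (- i)

-- The subset X of the setoid S has exactly k elements.
HasSize : ∀ {ℓ} (S : Setoid ℓ ℓ) → (Setoid.Carrier S → Set) → ℕ → Set ℓ
HasSize S X k =
  ∃ λ xs → Unique S xs × length xs ≡ k × (∀ x → X x ⇔ x ∈ₛ xs)
  where open SetoidMembership S renaming (_∈_ to _∈ₛ_)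

∣_∣≡_ : Pot → ℕ → Set
∣ P ∣≡ k = HasSize ↭-setoid (P ∋_) k

∣Σ_∣≡_ : Pot → ℕ → Set
∣Σ P ∣≡ k = HasSize (setoid ℤ) (Colors P) k

-- Only the values of f on ±Σ(P) matter.  Applying f to the tiles of P
-- presupposes that their entries lie in ±Σ(P), hence f-defined.
record _≅_ (P P′ : Pot) : Set where
  field
    f            : ℤ → ℤ
    f-into       : ∀ i → (± Colors P) i → (± Colors P′) (f i)
    f-injective  : ∀ i j → (± Colors P) i → (± Colors P) j → f i ≡ f j → i ≡ j
    f-surjective : ∀ j → (± Colors P′) j → ∃ λ i → (± Colors P) i × f i ≡ j
    f-odd        : ∀ i → (± Colors P) i → f (- i) ≡ - f i
    f-defined    : ∀ t → P ∋ t → All (± Colors P) t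
    f-image      : ∀ u → P′ ∋ u ⇔ (∃ λ t → P ∋ t × u ↭ map f t)

-- An edge-coloring with c colors; k : Fin c stands for the color k + 1.
Coloring : Graph → ℕ → Set
Coloring G c = Fin (#E G) → Fin c

module _ {G : Graph} (D : Orientation G) {c : ℕ} (col : Coloring G c) where
  open Orientation D

  color : Fin (#E G) → ℤ
  color e = +[1+ toℕ (col e) ]

  -- A loop at x contributes to both halves.
  tile : Fin (#V G) → Tile
  tile x = concatMap outgoing (allFin (#E G)) ++ concatMap incoming (allFin (#E G))
    where
    outgoing incoming : Fin (#E G) → List ℤ
    outgoing e = if does (tail e Fin.≟ x) then [ color e ] else []
    incoming e = if does (head e Fin.≟ x) then [ - color e ] else []

  inducedPot : Pot
  inducedPot = record
    { _∋_  = λ t → ∃ λ x → t ↭ tile x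
    ; resp = λ t↭u → map₂ (↭-trans (↭-sym t↭u))
    }

infix 4 _∈𝒪_ _3-realizes_

_∈𝒪_ : Graph → Pot → Set
G ∈𝒪 P = Σ (Orientation G) λ D → ∃ λ c → Σ (Coloring G c) λ col →
  inducedPot D col ⊆ₚ P

_3-realizes_ : Pot → Graph → Set
P 3-realizes G =
  G ∈𝒪 P × ¬ (∃ λ H → H ∈𝒪 P × ¬ (H ≃ G) × #V H ≤ #V G)

IsMinimum : ∀ {ℓ} → (ℕ → Set ℓ) → ℕ → Set ℓ
IsMinimum S k = S k × (∀ j → S j → k ≤ j)

T₃[_]≡_ : Graph → ℕ → Set₁
T₃[ G ]≡ k = IsMinimum (λ j → ∃ λ P → P 3-realizes G × ∣ P ∣≡ j) k

B₃[_]≡_ : Graph → ℕ → Set₁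
B₃[ G ]≡ k = IsMinimum (λ j → ∃ λ P → P 3-realizes G × ∣Σ P ∣≡ j) k

record Biminimal (G : Graph) (P : Pot) : Set₁ where
  field
    realizes  : P 3-realizes G
    size-T₃   : ∃ λ k → T₃[ G ]≡ k × ∣ P ∣≡ k
    colors-B₃ : ∃ λ k → B₃[ G ]≡ k × ∣Σ P ∣≡ k

-- Subtraction in ℤ₂.
_-₂_ : Fin 2 → Fin 2 → Fin 2
x -₂ y = (toℕ x + (2 ∸ toℕ y)) mod 2

unit : Fin 3 → Fin 3 → Fin 2
unit i j = if does (i Fin.≟ j) then 1F else 0F

-- Fin (2 ^ 3) stands for ℤ₂³ through the bijection finToFun.
CubeAdjacent : Fin (2 ^ 3) → Fin (2 ^ 3) → Set
CubeAdjacent x y = ∃ λ i → ∀ j → finToFun x j -₂ finToFun y j ≡ unit i j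

cubeAdjacent? : ∀ x y → Dec (CubeAdjacent x y)
cubeAdjacent? x y =
  Fin.any? λ i → Fin.all? λ j → (finToFun x j -₂ finToFun y j) Fin.≟ unit i j

-- One edge for every unordered pair of adjacent vertices.
cubeEdges : List (Fin (2 ^ 3) × Fin (2 ^ 3))
cubeEdges =
  filter (λ (x , y) → (x Fin.<? y) ×-dec cubeAdjacent? x y)
    (cartesianProduct (allFin (2 ^ 3)) (allFin (2 ^ 3)))

cubeEnds : Fin (length cubeEdges) → Fin (2 ^ 3) × Fin (2 ^ 3)
cubeEnds = lookup cubeEdges

private
  0ᵥ : Fin (2 ^ 3)
  0ᵥ = 0F

  -- Clears the last nonzero coordinate.
  parent : Fin (2 ^ 3) → Fin (2 ^ 3)
  parent = Vec.lookup (0F ∷ 0F ∷ 0F ∷ 2F ∷ 0F ∷ 4F ∷ 4F ∷ 6F ∷ [])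

  toParent : ∀ x → Star (Adjacent cubeEnds) x (parent x)
  toParent 0F = ε
  toParent 1F = (# 0 , inj₂ refl) ◅ ε
  toParent 2F = (# 1 , inj₂ refl) ◅ ε
  toParent 3F = (# 5 , inj₂ refl) ◅ ε
  toParent 4F = (# 2 , inj₂ refl) ◅ ε
  toParent 5F = (# 8 , inj₂ refl) ◅ ε
  toParent 6F = (# 9 , inj₂ refl) ◅ ε
  toParent 7F = (# 11 , inj₂ refl) ◅ ε

  parent³ : ∀ x → parent (parent (parent x)) ≡ 0ᵥ
  parent³ = from-yes (Fin.all? λ x → parent (parent (parent x)) Fin.≟ 0ᵥ)

  toZero : ∀ x → Star (Adjacent cubeEnds) x 0ᵥ
  toZero x = subst (Star _ x) (parent³ x)
    (toParent x ◅◅ toParent (parent x) ◅◅ toParent (parent (parent x)))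

  adjacent-sym : ∀ {x y} → Adjacent cubeEnds x y → Adjacent cubeEnds y x
  adjacent-sym = map₂ Sum.swap

cube : Graph
cube = record
  { #V        = 2 ^ 3
  ; #E        = length cubeEdges
  ; ends      = cubeEnds
  ; nonEmpty  = s≤s z≤n
  ; connected = λ x y → toZero x ◅◅ reverse adjacent-sym (toZero y)
  }

P₁ : Pot
P₁ = pot
  ( (+ 1 ∷ + 1 ∷ + 1 ∷ [])
  ∷ (+ 2 ∷ + 2 ∷ + 2 ∷ [])
  ∷ (- + 2 ∷ - + 3 ∷ - + 3 ∷ [])
  ∷ (- + 1 ∷ - + 4 ∷ - + 4 ∷ [])
  ∷ (- + 1 ∷ + 3 ∷ - + 5 ∷ [])
  ∷ (- + 2 ∷ + 4 ∷ + 5 ∷ [])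
  ∷ [])

P₂ : Pot
P₂ = pot
  ( (+ 1 ∷ + 1 ∷ + 1 ∷ [])
  ∷ (+ 2 ∷ + 2 ∷ + 2 ∷ [])
  ∷ (- + 2 ∷ - + 3 ∷ - + 3 ∷ [])
  ∷ (- + 1 ∷ - + 4 ∷ - + 4 ∷ [])
  ∷ (+ 3 ∷ + 4 ∷ + 5 ∷ [])
  ∷ (- + 1 ∷ - + 2 ∷ - + 5 ∷ [])
  ∷ [])

{-# OPTIONS --safe #-}

-- If two arcs of the same color swap their heads, all tiles stay the same, so the new
-- graph is again the cube.  A swap creates an odd cycle unless both arcs run from even to
-- odd vertices or both from odd to even ones, and it creates a double edge unless the two
-- edges share an end or are antipodal.  So every color class is a star or a pair of
-- antipodal edges, and reading colors at the even ends turns the oriented coloring into a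
-- labelling of the edges by nonzero integers that never takes opposite values.  The pot
-- is determined up to isomorphism by the kernel of this labelling.  P₂ 3-realizes the
-- cube, so a biminimal pot has at most six tiles and five colors.  There are 98 kernels
-- with at most five compatible classes; 74 of them have more than six tiles, and the
-- other 24 come from P₁ or P₂.
module Submission where

open import Defs
open import Data.Sum.Base using (_⊎_)
open import Data.Bool.Base using (Bool; true; false; not; if_then_else_)
import Data.Bool.Properties as Bool
open import Data.Empty using (⊥; ⊥-elim)
open import Data.Fin.Base using (Fin; Fin′; zero; suc; toℕ; opposite; inject; inject≤)
open import Data.Fin.Patterns
open import Data.Fin.Permutation using (Permutation′; _⟨$⟩ʳ_; transpose; inverseʳ)
import Data.Fin.Properties as Fin
open import Data.Integer.Base using (ℤ; +_; -[1+_]; +[1+_]; -_; 0ℤ)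
import Data.Integer.Base as ℤ
import Data.Integer.Properties as ℤ
open import Data.List.Base
  using (List; []; _∷_; [_]; _++_; length; lookup; map; concatMap; filter; deduplicate; tabulate; allFin)
open import Data.List.Membership.Propositional using (_∈_; find; lose)
open import Data.List.Membership.Propositional.Properties
  using (∈-∃++; ∈-allFin; ∈-concatMap⁺; ∈-concatMap⁻; ∈-filter⁺; ∈-filter⁻; ∈-lookup; ∈-map⁺; ∈-++⁺ˡ; ∈-++⁺ʳ; ∈-++⁻)
open import Data.List.Membership.Propositional.Properties.WithK using (unique∧set⇒bag)
import Data.List.Membership.Setoid.Properties as SetoidMembership
import Data.List.Properties as List
open import Data.List.Relation.Binary.BagAndSetEquality using (∼bag⇒↭)
open import Data.List.Relation.Binary.Permutation.Propositional as Permutation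
  using (_↭_; ↭-refl; ↭-sym; ↭-trans; ↭-reflexive; ↭-prep; ↭-swap; ↭-isEquivalence; ↭-setoid)
open import Data.List.Relation.Binary.Permutation.Propositional.Properties
  using (¬x∷xs↭[]; ∈-resp-↭; drop-∷; map⁺; shift; shifts; ++⁺; ++⁺ˡ; ↭-length)
open import Data.List.Relation.Unary.All as All using (All; []; _∷_)
import Data.List.Relation.Unary.All.Properties as All
open import Data.List.Relation.Unary.AllPairs as AllPairs using ([]; _∷_)
import Data.List.Relation.Unary.AllPairs.Properties as AllPairs
open import Data.List.Relation.Unary.Any as Any using (Any; here; there)
open import Data.List.Relation.Unary.Any.Properties using (lookup-index)
import Data.List.Relation.Unary.Unique.DecSetoid.Properties as UniqueDec
import Data.List.Relation.Unary.Unique.Propositional.Properties as Unique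
open import Data.List.Relation.Unary.Unique.Setoid using (Unique)
open import Data.Nat.Base as ℕ using (ℕ; zero; suc; s≤s)
open import Data.Nat.ListAction using (sum)
open import Data.Nat.ListAction.Properties using (sum-++; sum-↭)
import Data.Nat.Properties as ℕ
open import Data.Product.Base as Product using (∃; _×_; _,_; proj₁; proj₂; swap)
open import Data.Product.Properties using (≡-dec)
open import Data.Sum.Base using (inj₁; inj₂)
open import Data.Vec.Base as Vec using (Vec; []; _∷_)
open import Function.Base using (_∘_; case_of_; id)
open import Function.Bundles using (Equivalence; Injection; Inverse; _↔_; mk⇔; mk↔ₛ′)
open import Function.Definitions using (Injective)
open import Function.Properties.Inverse using (↔⇒↣)
open import Level using (Level)
open import Relation.Binary.Bundles using (Setoid; DecSetoid)
import Relation.Binary.Construct.Closure.ReflexiveTransitive as Star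
open Star using (Star; _◅_; kleisliStar)
import Relation.Binary.Construct.On as On
open import Relation.Binary.Definitions using (Decidable; DecidableEquality; tri<; tri≈; tri>)
open import Relation.Binary.PropositionalEquality
  using (_≡_; _≢_; refl; sym; trans; cong; cong₂; subst; setoid; module ≡-Reasoning)
open import Relation.Nullary.Decidable
  using (Dec; yes; no; does; from-yes; ¬?; map′; _×-dec_; _⊎-dec_; _→-dec_; decidable-stable)
open import Relation.Nullary.Negation using (¬_; contradiction)

-- A realization may use colors of any size and a pot is an arbitrary predicate on tiles, so neither
-- can be searched directly. Counting makes both finite. The absolute values of the labels are
-- colors of the pot, so five colors leave at most five label classes; and six distinct vertex tiles
-- in a pot of at most six tiles leave no room for any other tile. 3-realization excludes other
-- graphs only through a negation, so a swap merely yields that the new graph cannot differ from the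
-- cube. This suffices, because only contradictions are drawn from it. As graphs are connected by
-- definition, a swapped graph counts only after the two moved edges have been bypassed. The
-- surviving kernels consist of two three-edge stars, two two-edge stars and a pair of antipodal
-- edges. The centers of the large stars have equal parity for `P₂` and are antipodal for `P₁`. That
-- `P₂` 3-realizes the cube is linear algebra: weights on the colors fix how many vertices carry
-- each of five tiles, and the colors then force the arcs.

private variable
  a ℓ : Level
  A B C : Set a
  n k : ℕ

-- Decidable equality of tiles and bounds from sizes

_↭?_ : Decidable {A = Tile} _↭_
[]       ↭? []       = yes ↭-refl
[]       ↭? (y ∷ ys) = no (¬x∷xs↭[] ∘ ↭-sym)
(x ∷ xs) ↭? ys with Any.any? (x ℤ.≟_) ys
... | no  x∉ys = no (λ x∷xs↭ys → x∉ys (∈-resp-↭ x∷xs↭ys (here refl)))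
... | yes x∈ys with ∈-∃++ x∈ys
...   | as , bs , refl = map′
        (λ xs↭ → ↭-trans (↭-prep x xs↭) (↭-sym (shift x as bs)))
        (λ x∷xs↭ → drop-∷ (↭-trans x∷xs↭ (shift x as bs)))
        (xs ↭? (as ++ bs))

module _ (S : Setoid ℓ ℓ) where
  open Setoid S using (Carrier; _≈_) renaming (sym to ≈-sym)

  lookup-injective : ∀ {xs} → Unique S xs → ∀ i j → lookup xs i ≈ lookup xs j → i ≡ j
  lookup-injective (_ ∷ _)    zero    zero    _  = refl
  lookup-injective (x≉ ∷ _)   zero    (suc j) eq =
    contradiction eq (All.lookup x≉ (∈-lookup j))
  lookup-injective (x≉ ∷ _)   (suc i) zero    eq =
    contradiction (≈-sym eq) (All.lookup x≉ (∈-lookup i))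
  lookup-injective (_ ∷ xs!) (suc i) (suc j) eq = cong suc (lookup-injective xs! i j eq)

  module _ {X : Carrier → Set} (size : HasSize S X n) (n≤k : n ℕ.≤ k) where

    private
      enumerates  = proj₂ (proj₂ (proj₂ size))
      length≤     = ℕ.≤-trans (ℕ.≤-reflexive (proj₁ (proj₂ (proj₂ size)))) n≤k

    position : ∀ {x} → X x → Fin k
    position {x} x∈X = inject≤ (Any.index (Equivalence.to (enumerates x) x∈X)) length≤

    position-injective : ∀ {x y} (x∈X : X x) (y∈X : X y) → position x∈X ≡ position y∈X → x ≈ y
    position-injective {x} {y} x∈X y∈X eq = SetoidMembership.index-injective S
      (Equivalence.to (enumerates x) x∈X) (Equivalence.to (enumerates y) y∈X)
      (Fin.inject≤-injective length≤ length≤ _ _ eq)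

    -- Pigeonhole through the positions in the enumeration of `X`. This is how the size of a
    -- possibly undecidable pot becomes usable.
    unique⇒length≤ : ∀ {xs} → Unique S xs → All X xs → length xs ℕ.≤ k
    unique⇒length≤ xs! xs⊆X = Fin.injective⇒≤ {f = λ i → position (All.lookup xs⊆X (∈-lookup i))}
      λ {i} {j} eq → lookup-injective xs! i j (position-injective _ _ eq)

-- Kernels of functions into Fin k

SameKernel : (Fin n → A) → (Fin n → B) → Set _
SameKernel f g = ∀ i j → (f i ≡ f j → g i ≡ g j) × (g i ≡ g j → f i ≡ f j)

SameKernel-∷ : (f : Fin (suc n) → A) (g : Fin (suc n) → B) →
  SameKernel (f ∘ suc) (g ∘ suc) →
  (∀ j → (f zero ≡ f (suc j) → g zero ≡ g (suc j)) × (g zero ≡ g (suc j) → f zero ≡ f (suc j))) →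
  SameKernel f g
SameKernel-∷ f g ker ker₀ zero    zero    = (λ _ → refl) , (λ _ → refl)
SameKernel-∷ f g ker ker₀ zero    (suc j) = ker₀ j
SameKernel-∷ f g ker ker₀ (suc i) zero    = sym ∘ proj₁ (ker₀ i) ∘ sym , sym ∘ proj₂ (ker₀ i) ∘ sym
SameKernel-∷ f g ker ker₀ (suc i) (suc j) = ker i j

sameKernel? : DecidableEquality A → DecidableEquality B →
  (f : Fin n → A) (g : Fin n → B) → Dec (SameKernel f g)
sameKernel? _≟₁_ _≟₂_ f g = Fin.all? λ i → Fin.all? λ j →
  ((f i ≟₁ f j) →-dec (g i ≟₂ g j)) ×-dec ((g i ≟₂ g j) →-dec (f i ≟₁ f j))

Used : Vec (Fin k) n → Fin k → Set
Used v l = ∃ λ j → l ≡ Vec.lookup v j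

used? : (v : Vec (Fin k) n) (l : Fin k) → Dec (Used v l)
used? v l = Fin.any? λ j → l Fin.≟ Vec.lookup v j

-- Labels are introduced in increasing order, so that every kernel is listed
-- once and not once for every permutation of the labels.
Admissible : (Fin (suc n) → Fin (suc n) → Set) → Vec (Fin k) n → Fin k → Set
Admissible R v l = (∀ j → l ≡ Vec.lookup v j → R zero (suc j))
                 × (Used v l ⊎ (∀ (l′ : Fin′ l) → Used v (inject l′)))

admissible? : {R : Fin (suc n) → Fin (suc n) → Set} → Decidable R →
  (v : Vec (Fin k) n) (l : Fin k) → Dec (Admissible R v l)
admissible? R? v l =
  (Fin.all? λ j → (l Fin.≟ Vec.lookup v j) →-dec R? zero (suc j))
  ×-dec (used? v l ⊎-dec Fin.all? λ l′ → used? v (inject l′))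

patterns : ∀ k {n} {R : Fin n → Fin n → Set} → Decidable R → List (Vec (Fin k) n)
patterns k {zero}  R? = [ [] ]
patterns k {suc n} R? = concatMap (λ v → map (_∷ v) (filter (admissible? R? v) (allFin k)))
                                  (patterns k λ i j → R? (suc i) (suc j))

patterns-complete : {R : Fin n → Fin n → Set} (R? : Decidable R) → DecidableEquality A →
  (f : Fin n → A) (ι : Fin n → Fin k) →
  (∀ i j → ι i ≡ ι j → f i ≡ f j) → (∀ i j → f i ≡ f j → R i j) →
  ∃ λ v → v ∈ patterns k R? × SameKernel f (Vec.lookup v)
patterns-complete {n = zero}  R? _≟_ f ι ι⇒f f⇒R = [] , here refl , λ ()
patterns-complete {n = suc n} {k = k} {R = R} R? _≟_ f ι ι⇒f f⇒R
  with v , v∈ , ker ← patterns-complete (λ i j → R? (suc i) (suc j)) _≟_ (f ∘ suc) (ι ∘ suc)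
                        (λ i j → ι⇒f (suc i) (suc j)) (λ i j → f⇒R (suc i) (suc j))
  = extend (Fin.any? λ j → f zero ≟ f (suc j))
  where
  listed : ∀ l → Admissible R v l → l ∷ v ∈ patterns k R?
  listed l adm = ∈-concatMap⁺ _ (lose v∈ (∈-map⁺ (_∷ v) (∈-filter⁺ (admissible? R? v) (∈-allFin l) adm)))

  extend : Dec (∃ λ j → f zero ≡ f (suc j)) →
           ∃ λ v → v ∈ patterns k R? × SameKernel f (Vec.lookup v)
  extend (yes (j , f₀≡fⱼ)) = Vec.lookup v j ∷ v
    , listed _ ((λ i vⱼ≡vᵢ → f⇒R zero (suc i) (trans f₀≡fⱼ (proj₂ (ker j i) vⱼ≡vᵢ))) , inj₁ (j , refl))
    , SameKernel-∷ f _ ker λ i →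
        (λ f₀≡fᵢ → proj₁ (ker j i) (trans (sym f₀≡fⱼ) f₀≡fᵢ)) ,
        (λ vⱼ≡vᵢ → trans f₀≡fⱼ (proj₂ (ker j i) vⱼ≡vᵢ))
  extend (no f₀≢) with Fin.all? (used? v)
  -- If all `k` labels occur, one index for each of them together with `zero` gives `k + 1` indices
  -- with distinct values of `f`, hence with distinct values of `ι` in `Fin k`.
  ... | yes used = contradiction (Fin.injective⇒≤ {f = f′} f′-injective) ℕ.1+n≰n
    where
    f′ : Fin (suc k) → Fin k
    f′ zero    = ι zero
    f′ (suc l) = ι (suc (proj₁ (used l)))
    f′-injective : Injective _≡_ _≡_ f′
    f′-injective {zero}  {zero}  _  = refl
    f′-injective {zero}  {suc l} eq = contradiction (_ , ι⇒f _ _ eq) f₀≢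
    f′-injective {suc l} {zero}  eq = contradiction (_ , ι⇒f _ _ (sym eq)) f₀≢
    f′-injective {suc l} {suc m} eq = cong suc
      (trans (proj₂ (used l)) (trans (proj₁ (ker _ _) (ι⇒f _ _ eq)) (sym (proj₂ (used m)))))
  ... | no ¬used with l , l-unused , smaller-used ← Fin.¬∀⟶∃¬-smallest k (Used v) (used? v) ¬used =
    l ∷ v
    , listed l ((λ i l≡vᵢ → contradiction (i , l≡vᵢ) l-unused) , inj₂ smaller-used)
    , SameKernel-∷ f _ ker λ i →
        (λ f₀≡fᵢ → contradiction (i , f₀≡fᵢ) f₀≢) ,
        (λ l≡vᵢ → contradiction (i , l≡vᵢ) l-unused)

-- Signed edge-colorings of the cube

Vertex Edge : Set
Vertex = Fin 8
Edge   = Fin 12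

-- In the order of cubeEdges; the vertices with an even number of ones are 0, 3, 5 and 6.
evenEnd oddEnd : Edge → Vertex
evenEnd = Vec.lookup (0F ∷ 0F ∷ 0F ∷ 3F ∷ 5F ∷ 3F ∷ 6F ∷ 3F ∷ 5F ∷ 6F ∷ 5F ∷ 6F ∷ [])
oddEnd  = Vec.lookup (1F ∷ 2F ∷ 4F ∷ 1F ∷ 1F ∷ 2F ∷ 2F ∷ 7F ∷ 4F ∷ 4F ∷ 7F ∷ 7F ∷ [])

-- ε e is the label of e at its even end, hence - ε e the label at its odd end.
labels : (Edge → ℤ) → Vertex → Edge → Tile
labels ε x e = (if does (evenEnd e Fin.≟ x) then [ ε e ] else [])
            ++ (if does (oddEnd e Fin.≟ x) then [ - ε e ] else [])

opaque
  vertexTile : (Edge → ℤ) → Vertex → Tile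
  vertexTile ε x = concatMap (labels ε x) (allFin 12)

opaque
  unfolding vertexTile

  ∈-vertexTile⁻ : ∀ ε x {i} → i ∈ vertexTile ε x → ∃ λ e → i ≡ ε e ⊎ i ≡ - ε e
  ∈-vertexTile⁻ ε x i∈ with e , _ , i∈e ← find (∈-concatMap⁻ (labels ε x) {xs = allFin 12} i∈) = e , go i∈e
    where
    go : ∀ {i} → i ∈ labels ε x e → i ≡ ε e ⊎ i ≡ - ε e
    go i∈ with evenEnd e Fin.≟ x | oddEnd e Fin.≟ x
    go (here i≡)         | yes _ | _     = inj₁ i≡
    go (there (here i≡)) | yes _ | yes _ = inj₂ i≡
    go (here i≡)         | no _  | yes _ = inj₂ i≡

  ∈-vertexTile-even : ∀ ε e → ε e ∈ vertexTile ε (evenEnd e)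
  ∈-vertexTile-even ε e = ∈-concatMap⁺ (labels ε (evenEnd e)) (lose (∈-allFin e) go)
    where
    go : ε e ∈ labels ε (evenEnd e) e
    go with evenEnd e Fin.≟ evenEnd e
    ... | yes _ = here refl
    ... | no ≢  = contradiction refl ≢

  ∈-vertexTile-odd : ∀ ε e → - ε e ∈ vertexTile ε (oddEnd e)
  ∈-vertexTile-odd ε e = ∈-concatMap⁺ (labels ε (oddEnd e)) (lose (∈-allFin e) go)
    where
    go : - ε e ∈ labels ε (oddEnd e) e
    go with oddEnd e Fin.≟ oddEnd e
    ... | yes _ = ∈-++⁺ʳ _ (here refl)
    ... | no ≢  = contradiction refl ≢

SignSeparated : (Edge → ℤ) → Set
SignSeparated ε = ∀ e e′ → ε e ≢ - ε e′

module Transport {ε g : Edge → ℤ} (separated : SignSeparated ε)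
                 (ker : ∀ e e′ → ε e ≡ ε e′ → g e ≡ g e′) where

  -- The odd extension of the map from `ε e` to `g e`; sign separation keeps the first two cases
  -- apart. The last case is a dummy value, as `_≅_` looks only at ±Σ(P).
  transport : ℤ → ℤ
  transport z with Fin.any? (λ e → z ℤ.≟ ε e) | Fin.any? (λ e → z ℤ.≟ - ε e)
  ... | yes (e , _) | _           = g e
  ... | no _        | yes (e , _) = - g e
  ... | no _        | no _        = z

  transport-ε : ∀ e → transport (ε e) ≡ g e
  transport-ε e with Fin.any? (λ e′ → ε e ℤ.≟ ε e′) | Fin.any? (λ e′ → ε e ℤ.≟ - ε e′)
  ... | yes (e′ , eq) | _ = sym (ker e e′ eq)
  ... | no ∄          | _ = contradiction (e , refl) ∄

  transport-‿ε : ∀ e → transport (- ε e) ≡ - g e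
  transport-‿ε e with Fin.any? (λ e′ → - ε e ℤ.≟ ε e′) | Fin.any? (λ e′ → - ε e ℤ.≟ - ε e′)
  ... | yes (e′ , eq) | _             = contradiction (sym eq) (separated e′ e)
  ... | no _          | yes (e′ , eq) = cong -_ (sym (ker e e′ (ℤ.neg-injective eq)))
  ... | no _          | no ∄          = contradiction (e , refl) ∄

  opaque
    unfolding vertexTile

    transport-vertexTile : ∀ x → map transport (vertexTile ε x) ≡ vertexTile g x
    transport-vertexTile x = trans (List.map-concatMap transport (labels ε x) (allFin 12))
                                   (List.concatMap-cong go (allFin 12))
      where
      go : ∀ e → map transport (labels ε x e) ≡ labels g x e
      go e with does (evenEnd e Fin.≟ x) | does (oddEnd e Fin.≟ x)
      ... | true  | true  = cong₂ (λ i j → i ∷ j ∷ []) (transport-ε e) (transport-‿ε e)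
      ... | true  | false = cong [_] (transport-ε e)
      ... | false | true  = cong [_] (transport-‿ε e)
      ... | false | false = refl

  -- To be read contrapositively: vertices with different tiles under `g` have different tiles under
  -- `ε`. A small model `g` thus certifies distinct tiles in a pot with arbitrary integers.
  transport-↭ : ∀ x y → vertexTile ε x ↭ vertexTile ε y → vertexTile g x ↭ vertexTile g y
  transport-↭ x y x↭y rewrite sym (transport-vertexTile x) | sym (transport-vertexTile y) =
    map⁺ transport x↭y

-- Pots that consist of the vertex tiles of a labelling

record Describes (ε : Edge → ℤ) (P : Pot) : Set where
  field
    separated : SignSeparated ε
    tile∈     : ∀ x → P ∋ vertexTile ε x
    only      : ∀ t → P ∋ t → ∃ λ x → t ↭ vertexTile ε x

module _ {ε : Edge → ℤ} {P : Pot} (d : Describes ε P) where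
  open Describes d

  colors⇒ε : ∀ {i} → (± Colors P) i → ∃ λ e → i ≡ ε e ⊎ i ≡ - ε e
  colors⇒ε (inj₁ (_ , t , t∈P , i∈t)) with x , t↭ ← only t t∈P = ∈-vertexTile⁻ ε x (∈-resp-↭ t↭ i∈t)
  colors⇒ε {i} (inj₂ (_ , t , t∈P , -i∈t))
    with x , t↭ ← only t t∈P
    with ∈-vertexTile⁻ ε x (∈-resp-↭ t↭ -i∈t)
  ... | e , inj₁ -i≡ = e , inj₂ (trans (sym (ℤ.neg-involutive i)) (cong -_ -i≡))
  ... | e , inj₂ -i≡ = e , inj₁ (ℤ.neg-injective -i≡)

  ε⇒colors : ∀ e → (± Colors P) (ε e)
  ε⇒colors e with ℤ.<-cmp 0ℤ (ε e)
  ... | tri< 0<ε _ _ = inj₁ (0<ε , _ , tile∈ (evenEnd e) , ∈-vertexTile-even ε e)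
  -- A zero label would be its own negative.
  ... | tri≈ _ 0≡ε _ = contradiction (subst (λ i → i ≡ - i) 0≡ε refl) (separated e e)
  ... | tri> _ _ ε<0 = inj₂ (ℤ.neg-mono-< ε<0 , _ , tile∈ (oddEnd e) , ∈-vertexTile-odd ε e)

  ±Colors-neg : ∀ {i} → (± Colors P) i → (± Colors P) (- i)
  ±Colors-neg {i} (inj₁ c) = inj₂ (subst (Colors P) (sym (ℤ.neg-involutive i)) c)
  ±Colors-neg     (inj₂ c) = inj₁ c

module _ {ε g : Edge → ℤ} {P P′ : Pot} (d : Describes ε P) (d′ : Describes g P′)
         (ker : SameKernel ε g) where
  open Transport {ε} {g} (Describes.separated d) (λ e e′ → proj₁ (ker e e′))

  -- A vertex tile is assembled from labels and their negatives alone, so the odd bijection between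
  -- the two sets of labels carries the tile at each vertex to the tile at the same vertex.
  sameKernel⇒≅ : P ≅ P′
  sameKernel⇒≅ = record
    { f            = transport
    ; f-into       = into
    ; f-injective  = injective
    ; f-surjective = surjective
    ; f-odd        = odd
    ; f-defined    = λ t t∈P → All.tabulate λ {i} i∈t → defined t t∈P i∈t
    ; f-image      = λ u → mk⇔ (image u) (image⁻ u)
    }
    where
    into : ∀ i → (± Colors P) i → (± Colors P′) (transport i)
    into i c with colors⇒ε d c
    ... | e , inj₁ refl = subst (± Colors P′) (sym (transport-ε e)) (ε⇒colors d′ e)
    ... | e , inj₂ refl = subst (± Colors P′) (sym (transport-‿ε e)) (±Colors-neg d′ (ε⇒colors d′ e))

    injective : ∀ i j → (± Colors P) i → (± Colors P) j → transport i ≡ transport j → i ≡ j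
    injective i j ci cj eq with colors⇒ε d ci | colors⇒ε d cj
    ... | e , inj₁ refl | e′ , inj₁ refl =
      proj₂ (ker e e′) (trans (sym (transport-ε e)) (trans eq (transport-ε e′)))
    ... | e , inj₁ refl | e′ , inj₂ refl = contradiction
      (trans (sym (transport-ε e)) (trans eq (transport-‿ε e′))) (Describes.separated d′ e e′)
    ... | e , inj₂ refl | e′ , inj₁ refl = contradiction
      (trans (sym (transport-ε e′)) (trans (sym eq) (transport-‿ε e))) (Describes.separated d′ e′ e)
    ... | e , inj₂ refl | e′ , inj₂ refl = cong -_ (proj₂ (ker e e′) (ℤ.neg-injective
      (trans (sym (transport-‿ε e)) (trans eq (transport-‿ε e′)))))

    surjective : ∀ j → (± Colors P′) j → ∃ λ i → (± Colors P) i × transport i ≡ j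
    surjective j c with colors⇒ε d′ c
    ... | e , inj₁ refl = ε e , ε⇒colors d e , transport-ε e
    ... | e , inj₂ refl = - ε e , ±Colors-neg d (ε⇒colors d e) , transport-‿ε e

    odd : ∀ i → (± Colors P) i → transport (- i) ≡ - transport i
    odd i c with colors⇒ε d c
    ... | e , inj₁ refl = trans (transport-‿ε e) (cong -_ (sym (transport-ε e)))
    ... | e , inj₂ refl = begin
      transport (- - ε e)   ≡⟨ cong transport (ℤ.neg-involutive (ε e)) ⟩
      transport (ε e)       ≡⟨ transport-ε e ⟩
      g e                   ≡⟨ ℤ.neg-involutive (g e) ⟨
      - - g e               ≡⟨ cong -_ (transport-‿ε e) ⟨
      - transport (- ε e)   ∎
      where open ≡-Reasoning

    defined : ∀ t → P ∋ t → ∀ {i} → i ∈ t → (± Colors P) i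
    defined t t∈P i∈t with x , t↭ ← Describes.only d t t∈P with ∈-vertexTile⁻ ε x (∈-resp-↭ t↭ i∈t)
    ... | e , inj₁ refl = ε⇒colors d e
    ... | e , inj₂ refl = ±Colors-neg d (ε⇒colors d e)

    image : ∀ u → P′ ∋ u → ∃ λ t → P ∋ t × u ↭ map transport t
    image u u∈P′ with x , u↭ ← Describes.only d′ u u∈P′ =
      vertexTile ε x , Describes.tile∈ d x , ↭-trans u↭ (↭-reflexive (sym (transport-vertexTile x)))

    image⁻ : ∀ u → (∃ λ t → P ∋ t × u ↭ map transport t) → P′ ∋ u
    image⁻ u (t , t∈P , u↭) with x , t↭ ← Describes.only d t t∈P = Pot.resp P′
      (↭-sym (↭-trans u↭ (↭-trans (map⁺ transport t↭) (↭-reflexive (transport-vertexTile x)))))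
      (Describes.tile∈ d′ x)

-- Classification of the compatible kernels

CubeEdge : Vertex → Vertex → Set
CubeEdge x y = ∃ λ e → evenEnd e ≡ x × oddEnd e ≡ y

cubeEdge? : Decidable CubeEdge
cubeEdge? x y = Fin.any? λ e → (evenEnd e Fin.≟ x) ×-dec (oddEnd e Fin.≟ y)

-- Distinct compatible edges share an end or are antipodal.
Compatible : Edge → Edge → Set
Compatible e e′ = evenEnd e ≡ evenEnd e′
                ⊎ oddEnd e ≡ oddEnd e′
                ⊎ ¬ CubeEdge (evenEnd e) (oddEnd e′) × ¬ CubeEdge (evenEnd e′) (oddEnd e)

compatible? : Decidable Compatible
compatible? e e′ = (evenEnd e Fin.≟ evenEnd e′)
              ⊎-dec (oddEnd e Fin.≟ oddEnd e′)
              ⊎-dec ¬? (cubeEdge? _ _) ×-dec ¬? (cubeEdge? _ _)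

isEven : Vertex → Bool
isEven x = does (Fin.any? λ e → evenEnd e Fin.≟ x)

-- Both target colorings are read off from two vertices a and b of the same
-- parity; x is the end of the edge with that parity, y is the other end, and
-- opposite is the antipodal map.
alongParity : Vertex → (Vertex → Vertex → ℤ) → Edge → ℤ
alongParity a rule e =
  if isEven a then rule (evenEnd e) (oddEnd e) else - rule (oddEnd e) (evenEnd e)

coloring₁ coloring₂ : Vertex → Vertex → Edge → ℤ
coloring₁ a b = alongParity a λ x y →
  if does (x Fin.≟ a) then + 1 else
  if does (y Fin.≟ opposite a) then - + 2 else
  if does (x Fin.≟ b) then - + 3 else
  if does (y Fin.≟ opposite b) then + 4 else + 5
coloring₂ a b = alongParity a λ x y →
  if does (x Fin.≟ a) then + 1 else
  if does (x Fin.≟ b) then + 2 else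
  if does (y Fin.≟ opposite a) then + 3 else
  if does (y Fin.≟ opposite b) then + 4 else + 5

describes? : ∀ g ts → Dec (Describes g (pot ts))
describes? g ts = map′
  (λ (sep , tile∈ , used) → record
    { separated = sep
    ; tile∈     = tile∈
    ; only      = λ t t∈ → let u , u∈ts , t↭u = find t∈ ; x , u↭ = All.lookup used u∈ts
                           in x , ↭-trans t↭u u↭ })
  (λ d → let open Describes d in separated , tile∈ ,
    All.tabulate λ {t} t∈ts → only t (lose t∈ts ↭-refl))
  ((Fin.all? λ e → Fin.all? λ e′ → ¬? (g e ℤ.≟ - g e′))
  ×-dec (Fin.all? λ x → Any.any? (vertexTile g x ↭?_) ts)
  ×-dec All.all? (λ t → Fin.any? λ x → t ↭? vertexTile g x) ts)

-- Labels start at 1: a label 0 would be its own negative and could merge a tile at an even vertex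
-- with one at an odd vertex.
asColors : Vec (Fin 5) 12 → Edge → ℤ
asColors v e = +[1+ toℕ (Vec.lookup v e) ]

↭-decSetoid : DecSetoid _ _
↭-decSetoid = record
  { isDecEquivalence = record { isEquivalence = ↭-isEquivalence ; _≟_ = _↭?_ } }

tileDecSetoid : (Edge → ℤ) → DecSetoid _ _
tileDecSetoid ε = On.decSetoid ↭-decSetoid (vertexTile ε)

distinctVertices : Vec (Fin 5) 12 → List Vertex
distinctVertices v = deduplicate (DecSetoid._≟_ (tileDecSetoid (asColors v))) (allFin 8)

-- The 24 ordered pairs of distinct vertices of equal parity give twelve kernels for each pot:
-- exchanging `a` and `b` preserves the kernel of `coloring₂`, and replacing both by their antipodes
-- preserves that of `coloring₁`.
Matches : Vec (Fin 5) 12 → (Vertex → Vertex → Edge → ℤ) → Pot → Set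
Matches v coloring P = ∃ λ a → ∃ λ b → SameKernel (Vec.lookup v) (coloring a b) × Describes (coloring a b) P

-- The second case records six distinct tiles because an isomorphism of pots also requires that `P`
-- has no tile besides the vertex tiles.
Classified : Vec (Fin 5) 12 → Set
Classified v = 6 ℕ.< length (distinctVertices v)
             ⊎ 6 ℕ.≤ length (distinctVertices v) × (Matches v coloring₁ P₁ ⊎ Matches v coloring₂ P₂)

classified? : ∀ v → Dec (Classified v)
classified? v = (6 ℕ.<? _) ⊎-dec (6 ℕ.≤? _) ×-dec
  ((Fin.any? λ a → Fin.any? λ b → sameKernel? Fin._≟_ ℤ._≟_ _ _ ×-dec describes? (coloring₁ a b) _)
  ⊎-dec (Fin.any? λ a → Fin.any? λ b → sameKernel? Fin._≟_ ℤ._≟_ _ _ ×-dec describes? (coloring₂ a b) _))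

opaque
  unfolding vertexTile

  all-classified : All Classified (patterns 5 compatible?)
  all-classified = from-yes (All.all? classified? (patterns 5 compatible?))

-- Rearranging `concatMap`, and unordered pairs

concatMap-↭ : (f : A → List B) → ∀ {xs ys} → xs ↭ ys → concatMap f xs ↭ concatMap f ys
concatMap-↭ f Permutation.refl          = ↭-refl
concatMap-↭ f (Permutation.prep x p)    = ++⁺ˡ (f x) (concatMap-↭ f p)
concatMap-↭ f (Permutation.swap x y p)  =
  ↭-trans (shifts (f x) (f y)) (++⁺ˡ (f y) (++⁺ˡ (f x) (concatMap-↭ f p)))
concatMap-↭ f (Permutation.trans p q)   = ↭-trans (concatMap-↭ f p) (concatMap-↭ f q)

map-allFin-↭ : (π : Permutation′ n) → map (π ⟨$⟩ʳ_) (allFin n) ↭ allFin n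
map-allFin-↭ {n} π = ∼bag⇒↭ (unique∧set⇒bag
  (Unique.map⁺ (Injection.injective (↔⇒↣ π)) (Unique.allFin⁺ n)) (Unique.allFin⁺ n)
  λ {x} → mk⇔ (λ _ → ∈-allFin x)
    (λ _ → subst (_∈ _) (inverseʳ π) (∈-map⁺ (π ⟨$⟩ʳ_) (∈-allFin _))))

concatMap-permute : (f g : Fin n → List A) (π : Permutation′ n) → (∀ i → f i ≡ g (π ⟨$⟩ʳ i)) →
  concatMap f (allFin n) ↭ concatMap g (allFin n)
concatMap-permute {n} f g π f≡gπ = ↭-trans
  (↭-reflexive (trans (List.concatMap-cong f≡gπ (allFin n)) (sym (List.concatMap-map g _ (allFin n)))))
  (concatMap-↭ g (map-allFin-↭ π))

concatMap-++-↭ : (f g h : A → List B) → (∀ x → f x ++ g x ≡ h x) → ∀ xs →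
  concatMap f xs ++ concatMap g xs ↭ concatMap h xs
concatMap-++-↭ f g h eq []       = ↭-refl
concatMap-++-↭ f g h eq (x ∷ xs) = begin
  (f x ++ F) ++ (g x ++ G) ≡⟨ List.++-assoc (f x) F (g x ++ G) ⟩
  f x ++ (F ++ (g x ++ G)) ↭⟨ ++⁺ˡ (f x) (shifts F (g x)) ⟩
  f x ++ (g x ++ (F ++ G)) ≡⟨ List.++-assoc (f x) (g x) (F ++ G) ⟨
  (f x ++ g x) ++ (F ++ G) ≡⟨ cong (_++ (F ++ G)) (eq x) ⟩
  h x ++ (F ++ G)          ↭⟨ ++⁺ˡ (h x) (concatMap-++-↭ f g h eq xs) ⟩
  h x ++ concatMap h xs    ∎
  where
  open Permutation.PermutationReasoning
  F = concatMap f xs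
  G = concatMap g xs

∼-sym : {p q : A × A} → p ∼ q → q ∼ p
∼-sym (inj₁ refl) = inj₁ refl
∼-sym (inj₂ refl) = inj₂ refl

∼-trans : {p q r : A × A} → p ∼ q → q ∼ r → p ∼ r
∼-trans (inj₁ refl) q∼r         = q∼r
∼-trans (inj₂ refl) (inj₁ refl) = inj₂ refl
∼-trans (inj₂ refl) (inj₂ refl) = inj₁ refl

∼-map : (f : A → B) {p q : A × A} → p ∼ q → Product.map f f p ∼ Product.map f f q
∼-map f (inj₁ refl) = inj₁ refl
∼-map f (inj₂ refl) = inj₂ refl

_∼?_ : Decidable (_∼_ {Fin n})
p ∼? q = ≡-dec Fin._≟_ Fin._≟_ p q ⊎-dec ≡-dec Fin._≟_ Fin._≟_ p (swap q)

-- Swapping the heads of two arcs of the same color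

module Swap (G : Graph) (D : Orientation G) (e e′ : Fin (#E G)) where
  open Orientation D

  exchange : Permutation′ (#E G)
  exchange = transpose e e′

  swappedArc : Fin (#E G) → Fin (#V G) × Fin (#V G)
  swappedArc i = tail i , head (exchange ⟨$⟩ʳ i)

  swappedArc-e : swappedArc e ≡ (tail e , head e′)
  swappedArc-e with e Fin.≟ e
  ... | yes _  = refl
  ... | no e≢e = contradiction refl e≢e

  swappedArc-other : ∀ {i} → i ≢ e → i ≢ e′ → swappedArc i ≡ arc i
  swappedArc-other {i} i≢e i≢e′ with i Fin.≟ e
  ... | yes i≡e = contradiction i≡e i≢e
  ... | no _ with i Fin.≟ e′
  ...   | yes i≡e′ = contradiction i≡e′ i≢e′
  ...   | no _     = refl

  module _ (connected′ : ∀ x y → Star (Adjacent swappedArc) x y) where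

    swapped : Graph
    swapped = record
      { ends = swappedArc ; nonEmpty = nonEmpty G ; connected = connected′ }

    swappedOrientation : Orientation swapped
    swappedOrientation = record { arc = swappedArc ; orients = λ _ → inj₁ refl }

    -- The outgoing parts are literally the same; the incoming parts are reindexed by `exchange`,
    -- which preserves colors.
    tile-swapped : ∀ {c} (col : Coloring G c) → col e ≡ col e′ → ∀ x →
      tile swappedOrientation col x ↭ tile D col x
    tile-swapped col same x = ++⁺ˡ _ (concatMap-permute _ _ exchange λ i →
      cong (λ k → if does (head (exchange ⟨$⟩ʳ i) Fin.≟ x) then [ - +[1+ toℕ k ] ] else []) (col-exchange i))
      where
      col-exchange : ∀ i → col i ≡ col (exchange ⟨$⟩ʳ i)
      col-exchange i with i Fin.≟ e
      ... | yes refl = same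
      ... | no _ with i Fin.≟ e′
      ...   | yes refl = sym same
      ...   | no _     = refl

    swapped∈𝒪 : ∀ {P c} (col : Coloring G c) → inducedPot D col ⊆ₚ P → col e ≡ col e′ → swapped ∈𝒪 P
    swapped∈𝒪 col ⊆P same = swappedOrientation , _ , col ,
      λ t (x , t↭) → ⊆P t (x , ↭-trans t↭ (tile-swapped col same x))

-- Swaps that leave the isomorphism class of the cube

ends-cube : ∀ e → ends cube e ∼ (evenEnd e , oddEnd e)
ends-cube = from-yes (Fin.all? λ e → cubeEnds e ∼? (evenEnd e , oddEnd e))

cube-simple : ∀ e e′ → ends cube e ∼ ends cube e′ → e ≡ e′
cube-simple e e′ e∼e′ = go e e′ (∼-trans (∼-sym (ends-cube e)) (∼-trans e∼e′ (ends-cube e′)))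
  where
  go : ∀ e e′ → (evenEnd e , oddEnd e) ∼ (evenEnd e′ , oddEnd e′) → e ≡ e′
  go = from-yes (Fin.all? λ e → Fin.all? λ e′ →
    ((evenEnd e , oddEnd e) ∼? (evenEnd e′ , oddEnd e′)) →-dec (e Fin.≟ e′))

isEven-ends : ∀ e → isEven (evenEnd e) ≢ isEven (oddEnd e)
isEven-ends = from-yes (Fin.all? λ e → ¬? (isEven (evenEnd e) Bool.≟ isEven (oddEnd e)))

Avoiding : Edge → Edge → Vertex → Vertex → Set
Avoiding e e′ x y = ∃ λ i → i ≢ e × i ≢ e′ × (evenEnd i , oddEnd i) ∼ (x , y)

avoiding? : ∀ e e′ → Decidable (Avoiding e e′)
avoiding? e e′ x y = Fin.any? λ i → ¬? (i Fin.≟ e) ×-dec ¬? (i Fin.≟ e′) ×-dec ((evenEnd i , oddEnd i) ∼? (x , y))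

Detour : Edge → Edge → Set
Detour e e′ = ∃ λ p → Avoiding e e′ (evenEnd e) p ×
              ∃ λ q → Avoiding e e′ p q × Avoiding e e′ q (oddEnd e)

opaque

  -- One of the two squares through e does not contain e′.
  detour : ∀ e e′ → Detour e e′
  detour = from-yes (Fin.all? λ e → Fin.all? λ e′ →
    Fin.any? λ p → avoiding? e e′ (evenEnd e) p ×-dec
    Fin.any? λ q → avoiding? e e′ p q ×-dec avoiding? e e′ q (oddEnd e))

  common-neighbour : ∀ e e′ → ∃ λ i → ∃ λ j →
    evenEnd i ≡ evenEnd e × evenEnd j ≡ evenEnd e′ × oddEnd i ≡ oddEnd j
  common-neighbour = from-yes (Fin.all? λ e → Fin.all? λ e′ → Fin.any? λ i → Fin.any? λ j →
    (evenEnd i Fin.≟ evenEnd e) ×-dec (evenEnd j Fin.≟ evenEnd e′) ×-dec (oddEnd i Fin.≟ oddEnd j))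

≃cube⇒2-colorable : ∀ {G} → G ≃ cube →
  ∃ λ (p : Fin (#V G) → Bool) → ∀ e → p (proj₁ (ends G e)) ≢ p (proj₂ (ends G e))
≃cube⇒2-colorable {G} G≃ = isEven ∘ Inverse.to onV , λ e →
  go (Inverse.to onE e) (∼-trans (∼-sym (incidence e)) (ends-cube (Inverse.to onE e)))
  where
  open _≃_ G≃
  go : ∀ {x y} e → (x , y) ∼ (evenEnd e , oddEnd e) → isEven x ≢ isEven y
  go e (inj₁ refl) = isEven-ends e
  go e (inj₂ refl) = isEven-ends e ∘ sym

≃cube⇒simple : ∀ {G} → G ≃ cube → ∀ e e′ → ends G e ∼ ends G e′ → e ≡ e′
≃cube⇒simple {G} G≃ e e′ e∼e′ = Injection.injective (↔⇒↣ onE) (cube-simple _ _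
  (∼-trans (incidence e) (∼-trans (∼-map (Inverse.to onV) e∼e′) (∼-sym (incidence e′)))))
  where open _≃_ G≃

module CubeSwap (D : Orientation cube) (e e′ : Edge) where
  open Orientation D
  open Swap cube D e e′ public

  arc-ends : ∀ i → arc i ∼ (evenEnd i , oddEnd i)
  arc-ends i = ∼-trans (orients i) (ends-cube i)

  kept : ∀ {x y} → Avoiding e e′ x y → Adjacent swappedArc x y
  kept (i , i≢e , i≢e′ , i∼) =
    i , ∼-trans (inj₁ (swappedArc-other i≢e i≢e′)) (∼-trans (arc-ends i) i∼)

  Walk : Edge → Set
  Walk i = Adjacent swappedArc (evenEnd i) (oddEnd i)
         ⊎ ∃ λ p → ∃ λ q → Adjacent swappedArc (evenEnd i) p × Adjacent swappedArc p q
                           × Adjacent swappedArc q (oddEnd i)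

  avoiding-swap : ∀ {e e′ x y} → Avoiding e e′ x y → Avoiding e′ e x y
  avoiding-swap (i , i≢e , i≢e′ , i∼) = i , i≢e′ , i≢e , i∼

  walk : ∀ i → Walk i
  walk i with i Fin.≟ e | i Fin.≟ e′
  ... | no i≢e   | no i≢e′  = inj₁ (kept (i , i≢e , i≢e′ , inj₁ refl))
  ... | yes refl | _        with p , s₁ , q , s₂ , s₃ ← detour e e′ =
    inj₂ (p , q , kept s₁ , kept s₂ , kept s₃)
  ... | no _     | yes refl with p , s₁ , q , s₂ , s₃ ← detour e′ e =
    inj₂ (p , q , kept (avoiding-swap s₁) , kept (avoiding-swap s₂) , kept (avoiding-swap s₃))

  adjacent-sym : ∀ {x y} → Adjacent swappedArc x y → Adjacent swappedArc y x
  adjacent-sym (i , i∼) = i , ∼-trans i∼ (inj₂ refl)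

  swapped-connected : ∀ x y → Star (Adjacent swappedArc) x y
  swapped-connected x y = kleisliStar id (λ (i , i∼) → go i (∼-trans (∼-sym (ends-cube i)) i∼)) (connected cube x y)
    where
    path : ∀ i → Star (Adjacent swappedArc) (evenEnd i) (oddEnd i)
    path i with walk i
    ... | inj₁ s                       = s ◅ Star.ε
    ... | inj₂ (_ , _ , s₁ , s₂ , s₃)  = s₁ ◅ s₂ ◅ s₃ ◅ Star.ε

    go : ∀ {x y} i → (evenEnd i , oddEnd i) ∼ (x , y) → Star (Adjacent swappedArc) x y
    go i (inj₁ refl) = path i
    go i (inj₂ refl) = Star.reverse adjacent-sym (path i)

  -- A 2-coloring of the swapped graph is a 2-coloring of the cube as well, since
  -- the detours have odd length.  Hence it is constant on the even vertices.
  evenEnds-same : (p : Vertex → Bool) → (∀ i → p (proj₁ (swappedArc i)) ≢ p (proj₂ (swappedArc i))) →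
    p (evenEnd e) ≡ p (evenEnd e′)
  evenEnds-same p proper with i , j , i≡ , j≡ , i≡j ← common-neighbour e e′ = begin
    p (evenEnd e)        ≡⟨ cong p i≡ ⟨
    p (evenEnd i)        ≡⟨ odd-walk i ⟩
    not (p (oddEnd i))   ≡⟨ cong (not ∘ p) i≡j ⟩
    not (p (oddEnd j))   ≡⟨ odd-walk j ⟨
    p (evenEnd j)        ≡⟨ cong p j≡ ⟩
    p (evenEnd e′)       ∎
    where
    open ≡-Reasoning
    step : ∀ {x y} → Adjacent swappedArc x y → p x ≡ not (p y)
    step (i , inj₁ eq) = Bool.¬-not (subst (λ (x , y) → p x ≢ p y) eq (proper i))
    step (i , inj₂ eq) = Bool.¬-not (subst (λ (x , y) → p y ≢ p x) eq (proper i ∘ sym))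

    odd-walk : ∀ i → p (evenEnd i) ≡ not (p (oddEnd i))
    odd-walk i with walk i
    ... | inj₁ s = step s
    ... | inj₂ (_ , _ , s₁ , s₂ , s₃) =
      trans (step s₁) (trans (cong not (step s₂)) (trans (Bool.not-involutive _) (step s₃)))

  swappedCube : Graph
  swappedCube = swapped swapped-connected

  -- After the swap, `e` joins two even vertices, which every 2-coloring of the swapped graph colors
  -- alike.
  opposed⇒≄cube : arc e ≡ (evenEnd e , oddEnd e) → arc e′ ≡ (oddEnd e′ , evenEnd e′) →
    ¬ (swappedCube ≃ cube)
  opposed⇒≄cube arc-e arc-e′ ≃cube with p , proper ← ≃cube⇒2-colorable ≃cube =
    subst (λ (x , y) → p x ≢ p y)
      (trans swappedArc-e (cong₂ _,_ (cong proj₁ arc-e) (cong proj₂ arc-e′)))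
      (proper e) (evenEnds-same p proper)

  -- After the swap, `e` is parallel to the untouched edge `i`, whereas the cube is simple.
  doubled⇒≄cube : ∀ {i} → i ≢ e → i ≢ e′ → (tail e , head e′) ∼ (evenEnd i , oddEnd i) →
    ¬ (swappedCube ≃ cube)
  doubled⇒≄cube {i} i≢e i≢e′ e∼i ≃cube = i≢e (sym (≃cube⇒simple ≃cube e i
    (∼-trans (inj₁ swappedArc-e) (∼-trans e∼i
      (∼-trans (∼-sym (arc-ends i)) (inj₁ (sym (swappedArc-other i≢e i≢e′))))))))

-- The labelling obtained from a 3-realization

record Labelling (P : Pot) : Set where
  field
    label         : Edge → ℤ
    separated     : SignSeparated label
    compatible    : ∀ e e′ → label e ≡ label e′ → Compatible e e′
    -- Distinct labels use distinct colors, so a bound on the colors of the pot bounds the number of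
    -- labels.
    abs-injective : ∀ e e′ → ℤ.∣ label e ∣ ≡ ℤ.∣ label e′ ∣ → label e ≡ label e′
    vertexTile∈P  : ∀ x → P ∋ vertexTile label x

module Realization (D : Orientation cube) {c} (col : Coloring cube c) (P : Pot)
         (realizes : P 3-realizes cube) (⊆P : inducedPot D col ⊆ₚ P) where
  open Orientation D

  -- The swapped graph has the vertices of the cube, so the size condition of 3-realization holds
  -- with equality.
  swap-iso : ∀ e e′ → col e ≡ col e′ → ¬ ¬ (CubeSwap.swappedCube D e e′ ≃ cube)
  swap-iso e e′ same ≄cube = proj₂ realizes
    (swappedCube , swapped∈𝒪 swapped-connected {P = P} col ⊆P same , ≄cube , ℕ.≤-refl)
    where open CubeSwap D e e′

  direction : ∀ e → arc e ∼ (evenEnd e , oddEnd e)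
  direction e = ∼-trans (orients e) (ends-cube e)

  signed : ∀ {p q : Vertex × Vertex} → p ∼ q → ℤ → ℤ
  signed (inj₁ _) i = i
  signed (inj₂ _) i = - i

  evenLabel : Edge → ℤ
  evenLabel e = signed (direction e) (color D col e)

  opposed⇒⊥ : ∀ e e′ → col e ≡ col e′ →
    arc e ≡ (evenEnd e , oddEnd e) → arc e′ ≡ (oddEnd e′ , evenEnd e′) → ⊥
  opposed⇒⊥ e e′ same arc≡ arc′≡ = swap-iso e e′ same (CubeSwap.opposed⇒≄cube D e e′ arc≡ arc′≡)

  same-color⇒≡ : ∀ e e′ → col e ≡ col e′ → evenLabel e ≡ evenLabel e′
  same-color⇒≡ e e′ same with direction e | direction e′
  ... | inj₁ _    | inj₁ _     = cong (λ k → +[1+ toℕ k ]) same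
  ... | inj₂ _    | inj₂ _     = cong (λ k → - +[1+ toℕ k ]) same
  ... | inj₁ arc≡ | inj₂ arc′≡ = ⊥-elim (opposed⇒⊥ e e′ same arc≡ arc′≡)
  ... | inj₂ arc≡ | inj₁ arc′≡ = ⊥-elim (opposed⇒⊥ e′ e (sym same) arc′≡ arc≡)

  -- An even vertex is adjacent to all odd vertices but its antipode. Applied in both orders, this
  -- leaves only antipodal pairs among disjoint edges of one color.
  same-color⇒¬cubeEdge : ∀ e e′ → col e ≡ col e′ → evenEnd e ≢ evenEnd e′ → oddEnd e ≢ oddEnd e′ →
    ¬ CubeEdge (evenEnd e) (oddEnd e′)
  same-color⇒¬cubeEdge e e′ same even≢ odd≢ (i , i-even , i-odd) = go (direction e) (direction e′)
    where
    i≢e : i ≢ e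
    i≢e i≡e = odd≢ (trans (cong oddEnd (sym i≡e)) i-odd)

    i≢e′ : i ≢ e′
    i≢e′ i≡e′ = even≢ (trans (sym i-even) (cong evenEnd i≡e′))

    go : arc e ∼ (evenEnd e , oddEnd e) → arc e′ ∼ (evenEnd e′ , oddEnd e′) → ⊥
    go (inj₁ arc≡) (inj₁ arc′≡) = swap-iso e e′ same (CubeSwap.doubled⇒≄cube D e e′ i≢e i≢e′
      (inj₁ (cong₂ _,_ (trans (cong proj₁ arc≡) (sym i-even)) (trans (cong proj₂ arc′≡) (sym i-odd)))))
    -- Both arcs leave their odd ends, so it is `e′` that the swap makes parallel to `i`; hence the
    -- exchanged roles.
    go (inj₂ arc≡) (inj₂ arc′≡) = swap-iso e′ e (sym same) (CubeSwap.doubled⇒≄cube D e′ e i≢e′ i≢e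
      (inj₂ (cong₂ _,_ (trans (cong proj₁ arc′≡) (sym i-odd)) (trans (cong proj₂ arc≡) (sym i-even)))))
    go (inj₁ arc≡) (inj₂ arc′≡) = opposed⇒⊥ e e′ same arc≡ arc′≡
    go (inj₂ arc≡) (inj₁ arc′≡) = opposed⇒⊥ e′ e (sym same) arc′≡ arc≡

  same-color⇒compatible : ∀ e e′ → col e ≡ col e′ → Compatible e e′
  same-color⇒compatible e e′ same with evenEnd e Fin.≟ evenEnd e′ | oddEnd e Fin.≟ oddEnd e′
  ... | yes even≡ | _        = inj₁ even≡
  ... | no _      | yes odd≡ = inj₂ (inj₁ odd≡)
  ... | no even≢  | no odd≢  = inj₂ (inj₂
    (same-color⇒¬cubeEdge e e′ same even≢ odd≢ ,
     same-color⇒¬cubeEdge e′ e (sym same) (even≢ ∘ sym) (odd≢ ∘ sym)))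

  ∣evenLabel∣ : ∀ e → ℤ.∣ evenLabel e ∣ ≡ suc (toℕ (col e))
  ∣evenLabel∣ e with direction e
  ... | inj₁ _ = refl
  ... | inj₂ _ = refl

  ∣evenLabel∣≡⇒same-color : ∀ e e′ → ℤ.∣ evenLabel e ∣ ≡ ℤ.∣ evenLabel e′ ∣ → col e ≡ col e′
  ∣evenLabel∣≡⇒same-color e e′ eq = Fin.toℕ-injective (ℕ.suc-injective
    (trans (sym (∣evenLabel∣ e)) (trans eq (∣evenLabel∣ e′))))

  -- Opposite labels have the same absolute value, so the same color, so they are equal; but no
  -- label is zero.
  evenLabel-separated : SignSeparated evenLabel
  evenLabel-separated e e′ eq = ≢0 (self-neg (trans eq (cong -_ (sym (same-color⇒≡ e e′
    (∣evenLabel∣≡⇒same-color e e′ (trans (cong ℤ.∣_∣ eq) (ℤ.∣-i∣≡∣i∣ (evenLabel e′)))))))))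
    where
    self-neg : ∀ {i} → i ≡ - i → ℤ.∣ i ∣ ≡ 0
    self-neg {+ zero} _ = refl

    ≢0 : ℤ.∣ evenLabel e ∣ ≢ 0
    ≢0 eq with () ← trans (sym (∣evenLabel∣ e)) eq

  opaque
    unfolding vertexTile

    tile↭vertexTile : ∀ x → tile D col x ↭ vertexTile evenLabel x
    tile↭vertexTile x = concatMap-++-↭
      (λ e → if does (tail e Fin.≟ x) then [ color D col e ] else [])
      (λ e → if does (head e Fin.≟ x) then [ - color D col e ] else [])
      (labels evenLabel x) (λ e → go e (direction e)) (allFin 12)
      where
      go : ∀ e (d : arc e ∼ (evenEnd e , oddEnd e)) →
        (if does (tail e Fin.≟ x) then [ color D col e ] else [])
        ++ (if does (head e Fin.≟ x) then [ - color D col e ] else [])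
        ≡ (if does (evenEnd e Fin.≟ x) then [ signed d (color D col e) ] else [])
        ++ (if does (oddEnd e Fin.≟ x) then [ - signed d (color D col e) ] else [])
      go e (inj₁ arc≡) = cong (λ (u , v) →
        (if does (u Fin.≟ x) then [ color D col e ] else [])
        ++ (if does (v Fin.≟ x) then [ - color D col e ] else [])) arc≡
      go e (inj₂ arc≡) = trans
        (cong (λ (u , v) →
          (if does (u Fin.≟ x) then [ color D col e ] else [])
          ++ (if does (v Fin.≟ x) then [ - color D col e ] else [])) arc≡)
        disjoint
        where
        -- For a reversed arc the two pieces come in the other order, but the ends of `e` differ in
        -- parity, so at most one piece is nonempty.
        disjoint : (if does (oddEnd e Fin.≟ x) then [ color D col e ] else [])
          ++ (if does (evenEnd e Fin.≟ x) then [ - color D col e ] else [])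
          ≡ (if does (evenEnd e Fin.≟ x) then [ - color D col e ] else [])
          ++ (if does (oddEnd e Fin.≟ x) then [ - - color D col e ] else [])
        disjoint with oddEnd e Fin.≟ x | evenEnd e Fin.≟ x
        ... | yes odd≡ | yes even≡ =
          contradiction (cong isEven (trans even≡ (sym odd≡))) (isEven-ends e)
        ... | yes _    | no _      = refl
        ... | no _     | yes _     = refl
        ... | no _     | no _      = refl

3-realizes⇒labelling : ∀ {P} → P 3-realizes cube → Labelling P
3-realizes⇒labelling {P} realizes@((D , c , col , ⊆P) , _) = record
  { label         = evenLabel
  ; separated     = evenLabel-separated
  ; compatible    = λ e e′ eq → same-color⇒compatible e e′ (∣evenLabel∣≡⇒same-color e e′ (cong ℤ.∣_∣ eq))
  ; abs-injective = λ e e′ eq → same-color⇒≡ e e′ (∣evenLabel∣≡⇒same-color e e′ eq)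
  ; vertexTile∈P  = λ x → ⊆P _ (x , ↭-sym (tile↭vertexTile x))
  }
  where open Realization D col P realizes ⊆P

-- From the two sizes to an isomorphism

module _ {P : Pot} (labelling : Labelling P) where
  open Labelling labelling

  -- A positive label occurs in the tile at the even end; the negative of a negative label occurs at
  -- the odd end.
  abs∈Colors : ∀ e → Colors P (+ ℤ.∣ label e ∣)
  abs∈Colors e = go (label e) refl
    where
    go : ∀ i → label e ≡ i → Colors P (+ ℤ.∣ i ∣)
    go (+ zero) eq with () ← separated e e (trans eq (cong -_ (sym eq)))
    go (+[1+ n ]) eq = ℤ.+<+ ℕ.z<s , _ , vertexTile∈P (evenEnd e) ,
      subst (_∈ vertexTile label (evenEnd e)) eq (∈-vertexTile-even label e)
    go -[1+ n ] eq = ℤ.+<+ ℕ.z<s , _ , vertexTile∈P (oddEnd e) ,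
      subst (_∈ vertexTile label (oddEnd e)) (cong -_ eq) (∈-vertexTile-odd label e)

  module _ (v : Vec (Fin 5) 12) (ker : SameKernel label (Vec.lookup v))
           {k} (∣P∣≡k : ∣ P ∣≡ k) (k≤6 : k ℕ.≤ 6) where

    distinctTiles : List Tile
    distinctTiles = map (vertexTile label) (distinctVertices v)

    distinctTiles-unique : Unique ↭-setoid distinctTiles
    distinctTiles-unique = AllPairs.map⁺ (AllPairs.map (λ {x} {y} x≉y → x≉y ∘ transport-↭ x y)
      (UniqueDec.deduplicate-! (tileDecSetoid (asColors v)) (allFin 8)))
      where open Transport {label} {asColors v} separated
              (λ e e′ → cong (λ l → +[1+ toℕ l ]) ∘ proj₁ (ker e e′))

    distinctTiles⊆P : All (P ∋_) distinctTiles
    distinctTiles⊆P = All.map⁺ (All.universal vertexTile∈P (distinctVertices v))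

    fewTiles : ∀ {ts} → Unique ↭-setoid ts → All (P ∋_) ts → length ts ℕ.≤ 6
    fewTiles = unique⇒length≤ ↭-setoid ∣P∣≡k k≤6

    -- Any further tile of `P` would be a seventh. Arguing by contradiction is legitimate because
    -- `_↭_` is decidable, even if membership in `P` is not.
    describes : 6 ℕ.≤ length (distinctVertices v) → Describes label P
    describes 6≤ = record { separated = separated ; tile∈ = vertexTile∈P ; only = only }
      where
      only : ∀ t → P ∋ t → ∃ λ x → t ↭ vertexTile label x
      only t t∈P = decidable-stable (Fin.any? λ x → t ↭? vertexTile label x) λ ∄ →
        ℕ.<⇒≱ (s≤s (subst (6 ℕ.≤_) (sym (List.length-map (vertexTile label) (distinctVertices v))) 6≤))
          (fewTiles (All.map⁺ (All.universal (λ x t↭ → ∄ (x , t↭)) (distinctVertices v)) ∷ distinctTiles-unique)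
                    (t∈P ∷ distinctTiles⊆P))

    sameKernel-trans : {g : Edge → ℤ} → SameKernel (Vec.lookup v) g → SameKernel label g
    sameKernel-trans ker′ e e′ = proj₁ (ker′ e e′) ∘ proj₁ (ker e e′) , proj₂ (ker e e′) ∘ proj₂ (ker′ e e′)

    conclude : Classified v → (P ≅ P₁) ⊎ (P ≅ P₂)
    conclude (inj₁ 6<) = contradiction
      (subst (ℕ._≤ 6) (List.length-map (vertexTile label) (distinctVertices v))
        (fewTiles distinctTiles-unique distinctTiles⊆P)) (ℕ.<⇒≱ 6<)
    conclude (inj₂ (6≤ , inj₁ (a , b , ker′ , d))) =
      inj₁ (sameKernel⇒≅ (describes 6≤) d (sameKernel-trans ker′))
    conclude (inj₂ (6≤ , inj₂ (a , b , ker′ , d))) =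
      inj₂ (sameKernel⇒≅ (describes 6≤) d (sameKernel-trans ker′))

  fewSizes⇒≅ : ∀ {k j} → ∣ P ∣≡ k → k ℕ.≤ 6 → ∣Σ P ∣≡ j → j ℕ.≤ 5 → (P ≅ P₁) ⊎ (P ≅ P₂)
  fewSizes⇒≅ ∣P∣≡k k≤6 ∣ΣP∣≡j j≤5 =
    let v , v∈ , ker = patterns-complete compatible? ℤ._≟_ label shade shade⇒label compatible
    in conclude v ker ∣P∣≡k k≤6 (All.lookup all-classified v∈)
    where
    -- The position of the color of `e` in the enumeration of Σ(P); through it the labelling has at
    -- most five values.
    shade : Edge → Fin 5
    shade e = position (setoid ℤ) ∣ΣP∣≡j j≤5 (abs∈Colors e)

    shade⇒label : ∀ e e′ → shade e ≡ shade e′ → label e ≡ label e′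
    shade⇒label e e′ eq = abs-injective e e′
      (ℤ.+-injective (position-injective (setoid ℤ) ∣ΣP∣≡j j≤5 (abs∈Colors e) (abs∈Colors e′) eq))

-- Embeddings that are isomorphisms

injective⇒↔ : ∀ {m n} {f : Fin m → Fin n} → Injective _≡_ _≡_ f → n ℕ.≤ m →
  ∃ λ (I : Fin n ↔ Fin m) → ∀ i → Inverse.to I (f i) ≡ i
injective⇒↔ {m} {n} {f} f-inj n≤m =
  mk↔ₛ′ g f (λ i → f-inj (f∘g (f i))) f∘g , λ i → f-inj (f∘g (f i))
  where
  preimage : ∀ y → ∃ λ i → f i ≡ y
  preimage y = decidable-stable (Fin.any? λ i → f i Fin.≟ y) λ ∄ →
    let f′ : Fin (suc m) → Fin n
        f′ = λ { zero → y ; (suc i) → f i }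
        f′-inj : Injective _≡_ _≡_ f′
        f′-inj = λ { {zero}  {zero}  _  → refl
                   ; {zero}  {suc j} eq → contradiction (j , sym eq) ∄
                   ; {suc i} {zero}  eq → contradiction (i , eq) ∄
                   ; {suc i} {suc j} eq → cong suc (f-inj eq) }
    in ℕ.<⇒≱ (s≤s n≤m) (Fin.injective⇒≤ {f = f′} f′-inj)

  g : Fin n → Fin m
  g y = proj₁ (preimage y)

  f∘g : ∀ y → f (g y) ≡ y
  f∘g y = proj₂ (preimage y)

∼-map-injective : (f : A → B) → Injective _≡_ _≡_ f → {p q : A × A} →
  Product.map f f p ∼ Product.map f f q → p ∼ q
∼-map-injective f f-inj (inj₁ eq) = inj₁ (cong₂ _,_ (f-inj (cong proj₁ eq)) (f-inj (cong proj₂ eq)))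
∼-map-injective f f-inj (inj₂ eq) = inj₂ (cong₂ _,_ (f-inj (cong proj₁ eq)) (f-inj (cong proj₂ eq)))

-- As `G` is simple, an edge map lying over the injective `φ` is injective too, and injections into
-- sets that are no larger are bijections.
embedding⇒≃ : ∀ {G H} (φ : Fin (#V G) → Fin (#V H)) (ψ : Fin (#E G) → Fin (#E H)) →
  Injective _≡_ _≡_ φ → (∀ e → ends H (ψ e) ∼ Product.map φ φ (ends G e)) →
  (∀ e e′ → ends G e ∼ ends G e′ → e ≡ e′) → #V H ℕ.≤ #V G → #E H ℕ.≤ #E G → H ≃ G
embedding⇒≃ {G} {H} φ ψ φ-inj φψ simple V≤ E≤ = record
  { onV = onV ; onE = onE ; incidence = incidence }
  where
  ψ-inj : Injective _≡_ _≡_ ψ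
  ψ-inj {e} {e′} eq = simple e e′ (∼-map-injective φ φ-inj
    (∼-trans (∼-sym (φψ e)) (subst (λ i → ends H i ∼ _) (sym eq) (φψ e′))))

  onV : Fin (#V H) ↔ Fin (#V G)
  onV = proj₁ (injective⇒↔ φ-inj V≤)
  onE : Fin (#E H) ↔ Fin (#E G)
  onE = proj₁ (injective⇒↔ ψ-inj E≤)

  incidence : ∀ e → ends G (Inverse.to onE e) ∼ Product.map (Inverse.to onV) (Inverse.to onV) (ends H e)
  incidence e = ∼-trans
    (inj₁ (sym (cong₂ _,_ (proj₂ (injective⇒↔ φ-inj V≤) _) (proj₂ (injective⇒↔ φ-inj V≤) _))))
    (∼-map (Inverse.to onV) (∼-trans (∼-sym (φψ (Inverse.to onE e)))
      (inj₁ (cong (ends H) (Inverse.strictlyInverseʳ onE e)))))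

-- Double counting and weights of lists

concatMap-cong-↭ : {f g : A → List B} → (∀ x → f x ↭ g x) → ∀ xs → concatMap f xs ↭ concatMap g xs
concatMap-cong-↭ f↭g []       = ↭-refl
concatMap-cong-↭ f↭g (x ∷ xs) = ++⁺ (f↭g x) (concatMap-cong-↭ f↭g xs)

concatMap-[] : ∀ (xs : List A) → concatMap {B = B} (λ _ → []) xs ≡ []
concatMap-[] []       = refl
concatMap-[] (_ ∷ xs) = concatMap-[] xs

concatMap-comm : (h : A → B → List C) → ∀ xs ys →
  concatMap (λ x → concatMap (h x) ys) xs ↭ concatMap (λ y → concatMap (λ x → h x y) xs) ys
concatMap-comm h []       ys = ↭-reflexive (sym (concatMap-[] ys))
concatMap-comm h (x ∷ xs) ys = ↭-trans
  (++⁺ˡ (concatMap (h x) ys) (concatMap-comm h xs ys))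
  (concatMap-++-↭ (h x) (λ y → concatMap (λ x → h x y) xs) _ (λ _ → refl) ys)

concatMap-singleton : ∀ (y : Fin n) (c : A) →
  concatMap (λ x → if does (y Fin.≟ x) then [ c ] else []) (allFin n) ≡ [ c ]
concatMap-singleton {suc n} y c = trans (cong (f zero ++_) shifted) (go y)
  where
  f : Fin (suc n) → List _
  f x = if does (y Fin.≟ x) then [ c ] else []
  shifted : concatMap f (tabulate suc) ≡ concatMap (f ∘ suc) (allFin n)
  shifted = trans (cong (concatMap f) (sym (List.map-tabulate id suc))) (List.concatMap-map f suc (allFin n))
  go : ∀ y → (if does (y Fin.≟ zero) then [ c ] else [])
           ++ concatMap (λ x → if does (y Fin.≟ suc x) then [ c ] else []) (allFin n) ≡ [ c ]
  go zero    = cong (c ∷_) (concatMap-[] (allFin n))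
  go (suc y) = concatMap-singleton y c

length-concatMap : (f : A → List B) → (∀ x → length (f x) ≡ k) → ∀ xs → length (concatMap f xs) ≡ length xs ℕ.* k
length-concatMap f eq []       = refl
length-concatMap f eq (x ∷ xs) = trans (List.length-++ (f x)) (cong₂ ℕ._+_ (eq x) (length-concatMap f eq xs))

weight : (A → ℕ) → List A → ℕ
weight ω xs = sum (map ω xs)

weight-↭ : (ω : A → ℕ) {xs ys : List A} → xs ↭ ys → weight ω xs ≡ weight ω ys
weight-↭ ω p = sum-↭ (map⁺ ω p)

weight-concatMap : (ω : B → ℕ) (f : A → List B) → ∀ xs →
  weight ω (concatMap f xs) ≡ weight (weight ω ∘ f) xs
weight-concatMap ω f []       = refl
weight-concatMap ω f (x ∷ xs) = trans (cong sum (List.map-++ ω (f x) (concatMap f xs)))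
  (trans (sum-++ (map ω (f x)) _) (cong (weight ω (f x) ℕ.+_) (weight-concatMap ω f xs)))

filter-singleton : ∀ {p} {P : A → Set p} (P? : ∀ x → Dec (P x)) xs → length (filter P? xs) ≡ 1 →
  ∃ λ x → P x × ∀ {y} → y ∈ xs → P y → y ≡ x
filter-singleton P? xs eq with filter P? xs in eq′
filter-singleton P? xs refl | x ∷ [] =
  x , proj₂ (∈-filter⁻ P? {xs = xs} (subst (x ∈_) (sym eq′) (here refl))) , λ y∈ py →
    case subst (_ ∈_) eq′ (∈-filter⁺ P? y∈ py) of λ { (here y≡x) → y≡x }

filter-pair : ∀ {p} {P : A → Set p} (P? : ∀ x → Dec (P x)) {xs} →
  Unique (setoid A) xs → length (filter P? xs) ≡ 2 →
  ∃ λ x → ∃ λ y → P x × P y × x ≢ y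
filter-pair P? {xs} xs! eq with filter P? xs in eq′ | Unique.filter⁺ P? xs!
filter-pair P? {xs} xs! refl | x ∷ y ∷ [] | (x≢y ∷ []) ∷ _ =
  x , y , holds (here refl) , holds (there (here refl)) , x≢y
  where
  holds : ∀ {z} → z ∈ x ∷ y ∷ [] → _
  holds {z} z∈ = proj₂ (∈-filter⁻ P? {xs = xs} (subst (z ∈_) (sym eq′) z∈))

-- Half-edges

module HalfEdges {G : Graph} (D : Orientation G) {c} (col : Coloring G c) where
  open Orientation D

  outgoing incoming : Fin (#V G) → Fin (#E G) → Tile
  outgoing x e = if does (tail e Fin.≟ x) then [ color D col e ] else []
  incoming x e = if does (head e Fin.≟ x) then [ - color D col e ] else []

  bothEnds : Fin (#E G) → Tile
  bothEnds e = color D col e ∷ - color D col e ∷ []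

  allTiles : Tile
  allTiles = concatMap (tile D col) (allFin (#V G))

  -- Half-edges are counted by vertices and by edges: exchanging the two `concatMap`s collects one
  -- entry of each sign per edge.
  allTiles-↭ : allTiles ↭ concatMap bothEnds (allFin (#E G))
  allTiles-↭ = begin
    concatMap (tile D col) (allFin (#V G))
      ↭⟨ concatMap-cong-↭ (λ x → concatMap-++-↭ (outgoing x) (incoming x) _ (λ _ → refl) (allFin (#E G))) (allFin (#V G)) ⟩
    concatMap (λ x → concatMap (λ e → outgoing x e ++ incoming x e) (allFin (#E G))) (allFin (#V G))
      ↭⟨ concatMap-comm _ (allFin (#V G)) (allFin (#E G)) ⟩
    concatMap (λ e → concatMap (λ x → outgoing x e ++ incoming x e) (allFin (#V G))) (allFin (#E G))
      ↭⟨ concatMap-cong-↭ collect (allFin (#E G)) ⟩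
    concatMap bothEnds (allFin (#E G)) ∎
    where
    open Permutation.PermutationReasoning
    collect : ∀ e → concatMap (λ x → outgoing x e ++ incoming x e) (allFin (#V G)) ↭ bothEnds e
    collect e = ↭-trans
      (↭-sym (concatMap-++-↭ (λ x → outgoing x e) (λ x → incoming x e) _ (λ _ → refl) (allFin (#V G))))
      (↭-reflexive (cong₂ _++_ (concatMap-singleton (tail e) (color D col e))
                               (concatMap-singleton (head e) (- color D col e))))

  allTiles-neg-↭ : allTiles ↭ map -_ allTiles
  allTiles-neg-↭ = ↭-trans allTiles-↭ (↭-trans
    (concatMap-cong-↭ (λ e → ↭-swap _ _ ↭-refl) (allFin (#E G)))
    (↭-trans (↭-reflexive (sym (List.map-concatMap -_ bothEnds (allFin (#E G)))))
             (map⁺ -_ (↭-sym allTiles-↭))))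

  -- The multiset of all half-edges is invariant under negation, and every additive weight tests
  -- this.
  handshake : (ω : ℤ → ℕ) →
    weight (weight ω ∘ tile D col) (allFin (#V G)) ≡ weight (weight (ω ∘ -_) ∘ tile D col) (allFin (#V G))
  handshake ω = begin
    weight (weight ω ∘ tile D col) (allFin (#V G))         ≡⟨ weight-concatMap ω (tile D col) (allFin (#V G)) ⟨
    weight ω allTiles                                      ≡⟨ weight-↭ ω allTiles-neg-↭ ⟩
    sum (map ω (map -_ allTiles))                          ≡⟨ cong sum (List.map-∘ allTiles) ⟨
    weight (ω ∘ -_) allTiles                               ≡⟨ weight-concatMap (ω ∘ -_) (tile D col) (allFin (#V G)) ⟩
    weight (weight (ω ∘ -_) ∘ tile D col) (allFin (#V G))  ∎
    where open ≡-Reasoning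

  cubic⇒3V≡2E : (∀ x → length (tile D col x) ≡ 3) → #V G ℕ.* 3 ≡ #E G ℕ.* 2
  cubic⇒3V≡2E cubic = begin
    #V G ℕ.* 3                                   ≡⟨ cong (ℕ._* 3) (List.length-tabulate {n = #V G} id) ⟨
    length (allFin (#V G)) ℕ.* 3                 ≡⟨ length-concatMap (tile D col) cubic (allFin (#V G)) ⟨
    length allTiles                              ≡⟨ ↭-length allTiles-↭ ⟩
    length (concatMap bothEnds (allFin (#E G)))  ≡⟨ length-concatMap bothEnds (λ _ → refl) (allFin (#E G)) ⟩
    length (allFin (#E G)) ℕ.* 2                 ≡⟨ cong (ℕ._* 2) (List.length-tabulate {n = #E G} id) ⟩
    #E G ℕ.* 2                                   ∎
    where open ≡-Reasoning

  ∈-outgoing⁻ : ∀ x e {i} → i ∈ outgoing x e → tail e ≡ x × i ≡ color D col e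
  ∈-outgoing⁻ x e i∈ with tail e Fin.≟ x
  ∈-outgoing⁻ x e (here i≡) | yes tail≡ = tail≡ , i≡

  ∈-incoming⁻ : ∀ x e {i} → i ∈ incoming x e → head e ≡ x × i ≡ - color D col e
  ∈-incoming⁻ x e i∈ with head e Fin.≟ x
  ∈-incoming⁻ x e (here i≡) | yes head≡ = head≡ , i≡

  ∈-tile⁻ : ∀ x {i} → i ∈ tile D col x →
    ∃ λ e → (tail e ≡ x × i ≡ color D col e) ⊎ (head e ≡ x × i ≡ - color D col e)
  ∈-tile⁻ x i∈ with ∈-++⁻ (concatMap (outgoing x) (allFin (#E G))) i∈
  ... | inj₁ i∈out with e , _ , i∈e ← find (∈-concatMap⁻ (outgoing x) {xs = allFin (#E G)} i∈out) =
    e , inj₁ (∈-outgoing⁻ x e i∈e)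
  ... | inj₂ i∈in with e , _ , i∈e ← find (∈-concatMap⁻ (incoming x) {xs = allFin (#E G)} i∈in) =
    e , inj₂ (∈-incoming⁻ x e i∈e)

  outEdge : ∀ {x k} → +[1+ k ] ∈ tile D col x → ∃ λ e → tail e ≡ x × color D col e ≡ +[1+ k ]
  outEdge {x} k∈ with ∈-tile⁻ x k∈
  ... | e , inj₁ (tail≡ , i≡) = e , tail≡ , sym i≡

  inEdge : ∀ {x k} → -[1+ k ] ∈ tile D col x → ∃ λ e → head e ≡ x × color D col e ≡ +[1+ k ]
  inEdge {x} k∈ with ∈-tile⁻ x k∈
  ... | e , inj₂ (head≡ , i≡) = e , head≡ , ℤ.neg-injective (sym i≡)

  color∈tail : ∀ e → color D col e ∈ tile D col (tail e)
  color∈tail e = ∈-++⁺ˡ (∈-concatMap⁺ (outgoing (tail e)) (lose (∈-allFin e) go))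
    where
    go : color D col e ∈ outgoing (tail e) e
    go with tail e Fin.≟ tail e
    ... | yes _ = here refl
    ... | no ≢  = contradiction refl ≢

  incoming-head : ∀ e → incoming (head e) e ≡ [ - color D col e ]
  incoming-head e with head e Fin.≟ head e
  ... | yes _ = refl
  ... | no ≢  = contradiction refl ≢

  color∈head : ∀ e → - color D col e ∈ tile D col (head e)
  color∈head e = ∈-++⁺ʳ _ (∈-concatMap⁺ (incoming (head e)) (lose (∈-allFin e)
    (subst (_ ∈_) (sym (incoming-head e)) (here refl))))

  extract : ∀ {xs : List (Fin (#E G))} {e} → e ∈ xs → ∃ λ ys → xs ↭ e ∷ ys
  extract e∈ with as , bs , refl ← ∈-∃++ e∈ = as ++ bs , shift _ as bs

  -- Membership ignores multiplicity; this shows that two arcs with a common head account for two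
  -- separate entries of its tile.
  incoming-twice : ∀ {e e′} → e ≢ e′ → head e ≡ head e′ →
    ∃ λ t → tile D col (head e) ↭ - color D col e ∷ - color D col e′ ∷ t
  incoming-twice {e} {e′} e≢e′ same
    with ys , all↭ ← extract (∈-allFin e)
    with ∈-resp-↭ all↭ (∈-allFin e′)
  ... | here e′≡e = contradiction (sym e′≡e) e≢e′
  ... | there e′∈ys with zs , ys↭ ← extract e′∈ys = _ , (begin
    out ++ concatMap (incoming x) (allFin (#E G))
      ↭⟨ ++⁺ˡ out (concatMap-↭ (incoming x) (↭-trans all↭ (↭-prep e ys↭))) ⟩
    out ++ (incoming x e ++ (incoming x e′ ++ concatMap (incoming x) zs))
      ≡⟨ cong (out ++_) (cong₂ (λ s t → s ++ (t ++ concatMap (incoming x) zs))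
           (incoming-head e) (trans (cong (λ x → incoming x e′) same) (incoming-head e′))) ⟩
    out ++ (- color D col e ∷ - color D col e′ ∷ concatMap (incoming x) zs)
      ↭⟨ shifts out (- color D col e ∷ - color D col e′ ∷ []) ⟩
    - color D col e ∷ - color D col e′ ∷ (out ++ concatMap (incoming x) zs) ∎)
    where
    open Permutation.PermutationReasoning
    x = head e
    out = concatMap (outgoing x) (allFin (#E G))

-- Graphs with at most eight vertices realized by P₂

TileType : Set
TileType = Fin 6

tiles₂ : List Tile
tiles₂ = (+ 1 ∷ + 1 ∷ + 1 ∷ [])
       ∷ (+ 2 ∷ + 2 ∷ + 2 ∷ [])
       ∷ (- + 2 ∷ - + 3 ∷ - + 3 ∷ [])
       ∷ (- + 1 ∷ - + 4 ∷ - + 4 ∷ [])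
       ∷ (+ 3 ∷ + 4 ∷ + 5 ∷ [])
       ∷ (- + 1 ∷ - + 2 ∷ - + 5 ∷ [])
       ∷ []

tileOf : TileType → Tile
tileOf = lookup tiles₂

table : List (ℤ × ℕ) → ℤ → ℕ
table ps i = weight (λ (k , w) → if does (k ℤ.≟ i) then w else 0) ps

-- The handshake turns such an ω into 3 m #V = 24 N, where N is the number of vertices
-- of type j₀; ω is found by solving a linear system in the five colors.
Isolates : (ℤ → ℕ) → TileType → ℕ → Set
Isolates ω j₀ m = ∀ j → weight ω (tileOf j) ℕ.+ 3 ℕ.* m
                      ≡ weight (ω ∘ -_) (tileOf j) ℕ.+ (if does (j Fin.≟ j₀) then 24 else 0)

isolates? : ∀ ω j₀ m → Dec (Isolates ω j₀ m)
isolates? ω j₀ m = Fin.all? λ j → _ ℕ.≟ _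

-- The differences between the weights of `k` and `- k` are 7, -1, 2, -2, -3 for the colors 1 to 5.
-- The tiles of types `0F` to `4F` determine them one after the other, and type `5F` is then
-- satisfied. Negative differences are stored at `- k` to keep weights natural.
weightsA : List (ℤ × ℕ)
weightsA = (+ 1 , 7) ∷ (- + 2 , 1) ∷ (+ 3 , 2) ∷ (- + 4 , 2) ∷ (- + 5 , 3) ∷ []

weightsA-isolate : Isolates (table weightsA) 0F 1
weightsA-isolate = from-yes (isolates? (table weightsA) 0F 1)

count-isolated : ∀ {ω j₀ m} → Isolates ω j₀ m → (τ : A → TileType) → ∀ xs →
  weight (weight ω ∘ tileOf ∘ τ) xs ℕ.+ length xs ℕ.* (3 ℕ.* m)
  ≡ weight (weight (ω ∘ -_) ∘ tileOf ∘ τ) xs ℕ.+ length (filter (λ x → τ x Fin.≟ j₀) xs) ℕ.* 24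
count-isolated iso τ [] = refl
count-isolated {ω = ω} {j₀} {m} iso τ (x ∷ xs) = begin
  (w ℕ.+ W) ℕ.+ (3 ℕ.* m ℕ.+ L)      ≡⟨ interchange w W (3 ℕ.* m) L ⟩
  (w ℕ.+ 3 ℕ.* m) ℕ.+ (W ℕ.+ L)      ≡⟨ cong₂ ℕ._+_ (iso (τ x)) (count-isolated {m = m} iso τ xs) ⟩
  (w′ ℕ.+ δ) ℕ.+ (W′ ℕ.+ N ℕ.* 24)   ≡⟨ interchange w′ δ W′ (N ℕ.* 24) ⟩
  (w′ ℕ.+ W′) ℕ.+ (δ ℕ.+ N ℕ.* 24)   ≡⟨ cong ((w′ ℕ.+ W′) ℕ.+_) filter-step ⟩
  (w′ ℕ.+ W′) ℕ.+ length (filter (λ x → τ x Fin.≟ j₀) (x ∷ xs)) ℕ.* 24 ∎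
  where
  open ≡-Reasoning
  open import Algebra.Properties.CommutativeSemigroup ℕ.+-commutativeSemigroup using (interchange)
  rest = filter (λ x → τ x Fin.≟ j₀) xs
  w = weight ω (tileOf (τ x))
  w′ = weight (ω ∘ -_) (tileOf (τ x))
  W = weight (weight ω ∘ tileOf ∘ τ) xs
  W′ = weight (weight (ω ∘ -_) ∘ tileOf ∘ τ) xs
  L = length xs ℕ.* (3 ℕ.* m)
  N = length rest
  δ = if does (τ x Fin.≟ j₀) then 24 else 0
  filter-step : δ ℕ.+ N ℕ.* 24 ≡ length (filter (λ x → τ x Fin.≟ j₀) (x ∷ xs)) ℕ.* 24
  filter-step with does (τ x Fin.≟ j₀)
  ... | true  = refl
  ... | false = refl

Occurs : ℤ → TileType → Set
Occurs i j = ∀ j′ → i ∈ tileOf j′ → j′ ≡ j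

occurs? : ∀ i j → Dec (Occurs i j)
occurs? i j = Fin.all? λ j′ → Any.any? (i ℤ.≟_) (tileOf j′) →-dec (j′ Fin.≟ j)

pattern 10F = suc 9F
pattern 11F = suc 10F

module SmallGraph {H : Graph} (D : Orientation H) {c} (col : Coloring H c)
                  (⊆P₂ : inducedPot D col ⊆ₚ P₂) (H≤8 : #V H ℕ.≤ 8) where
  open Orientation D
  open HalfEdges D col

  listed : ∀ x → Any (tile D col x ↭_) tiles₂
  listed x = ⊆P₂ _ (x , ↭-refl)

  τ : Fin (#V H) → TileType
  τ x = Any.index (listed x)

  tile↭ : ∀ x → tile D col x ↭ tileOf (τ x)
  tile↭ x = lookup-index (listed x)

  count : TileType → ℕ
  count j = length (filter (λ x → τ x Fin.≟ j) (allFin (#V H)))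

  V≡length : #V H ≡ length (allFin (#V H))
  V≡length = sym (List.length-tabulate {n = #V H} id)

  type-count : ∀ {ω j m} → Isolates ω j m → #V H ℕ.* (3 ℕ.* m) ≡ count j ℕ.* 24
  type-count {ω} {j} {m} iso = ℕ.+-cancelˡ-≡ (weight (weight ω ∘ tileOf ∘ τ) xs) _ _ (begin
    W ω ℕ.+ #V H ℕ.* (3 ℕ.* m)        ≡⟨ cong (λ n → W ω ℕ.+ n ℕ.* (3 ℕ.* m)) V≡length ⟩
    W ω ℕ.+ length xs ℕ.* (3 ℕ.* m)   ≡⟨ count-isolated {m = m} iso τ xs ⟩
    W (ω ∘ -_) ℕ.+ count j ℕ.* 24         ≡⟨ cong (ℕ._+ count j ℕ.* 24) balanced ⟨
    W ω ℕ.+ count j ℕ.* 24                ∎)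
    where
    open ≡-Reasoning
    xs = allFin (#V H)
    W : (ℤ → ℕ) → ℕ
    W ω = weight (weight ω ∘ tileOf ∘ τ) xs

    by-type : ∀ ω → weight (weight ω ∘ tile D col) xs ≡ W ω
    by-type ω = cong sum (List.map-cong (λ x → weight-↭ ω (tile↭ x)) xs)

    balanced : W ω ≡ W (ω ∘ -_)
    balanced = trans (sym (by-type ω)) (trans (handshake ω) (by-type (ω ∘ -_)))

  -- Exactly one eighth of the vertices have type `0F`, so the number of vertices is a positive
  -- multiple of 8.
  V≡8 : #V H ≡ 8
  V≡8 = trans V≡8# (cong (ℕ._* 8) (one (count 0F) V≡8#))
    where
    V≡8# : #V H ≡ count 0F ℕ.* 8
    V≡8# = ℕ.*-cancelʳ-≡ _ _ 3 (trans (type-count {m = 1} weightsA-isolate)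
                                      (sym (ℕ.*-assoc (count 0F) 8 3)))
    one : ∀ k → #V H ≡ k ℕ.* 8 → k ≡ 1
    one 0             V≡ = contradiction (sym V≡) (ℕ.<⇒≢ (nonEmpty H))
    one 1             V≡ = refl
    one (suc (suc k)) V≡ = contradiction (subst (ℕ._≤ 8) V≡ H≤8) (ℕ.<⇒≱ (ℕ.m≤m+n 9 (7 ℕ.+ k ℕ.* 8)))

  count≡ : ∀ {ω j} m → Isolates ω j m → count j ≡ m
  count≡ {ω} {j} m iso = ℕ.*-cancelʳ-≡ (count j) m 24 (begin
    count j ℕ.* 24           ≡⟨ type-count {m = m} iso ⟨
    #V H ℕ.* (3 ℕ.* m)   ≡⟨ cong (ℕ._* (3 ℕ.* m)) V≡8 ⟩
    8 ℕ.* (3 ℕ.* m)      ≡⟨ ℕ.*-assoc 8 3 m ⟨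
    24 ℕ.* m             ≡⟨ ℕ.*-comm 24 m ⟩
    m ℕ.* 24             ∎)
    where open ≡-Reasoning

  SoleVertex : TileType → Set
  SoleVertex j = ∃ λ x → τ x ≡ j × ∀ {y} → τ y ≡ j → y ≡ x

  soleVertex : ∀ {ω j} → Isolates ω j 1 → SoleVertex j
  soleVertex {j = j} iso
    with x , τx≡j , only ← filter-singleton (λ x → τ x Fin.≟ j) (allFin (#V H)) (count≡ 1 iso) =
    x , τx≡j , λ {y} → only (∈-allFin y)

  ∈tile : ∀ {x j i} → τ x ≡ j → i ∈ tileOf j → i ∈ tile D col x
  ∈tile {x} refl = ∈-resp-↭ (↭-sym (tile↭ x))

  Joined : ℕ → Fin (#V H) → Fin (#V H) → Set
  Joined k x y = ∃ λ e → arc e ≡ (x , y) × color D col e ≡ +[1+ k ]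

  joinTo : ∀ {j k} → Occurs -[1+ k ] j → ∀ {x} → +[1+ k ] ∈ tile D col x → ∃ λ y → τ y ≡ j × Joined k x y
  joinTo occurs k∈ with e , refl , col≡ ← outEdge k∈ =
    head e , occurs _ (∈-resp-↭ (tile↭ (head e)) (subst (λ i → - i ∈ tile D col (head e)) col≡ (color∈head e)))
    , e , refl , col≡

  joinFrom : ∀ {j k} → Occurs +[1+ k ] j → ∀ {y} → -[1+ k ] ∈ tile D col y → ∃ λ x → τ x ≡ j × Joined k x y
  joinFrom occurs -k∈ with e , refl , col≡ ← inEdge -k∈ =
    tail e , occurs _ (∈-resp-↭ (tile↭ (tail e)) (subst (_∈ tile D col (tail e)) col≡ (color∈tail e)))
    , e , refl , col≡

  opaque

    vertexA : SoleVertex 0F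
    vertexA = soleVertex weightsA-isolate

    vertexB : SoleVertex 1F
    vertexB = soleVertex (from-yes (isolates? (table
      ((- + 1 , 1) ∷ (+ 2 , 7) ∷ (- + 3 , 2) ∷ (+ 4 , 2) ∷ (- + 5 , 3) ∷ [])) 1F 1))

    vertexC : SoleVertex 2F
    vertexC = soleVertex (from-yes (isolates? (table
      ((- + 1 , 1) ∷ (- + 2 , 1) ∷ (- + 3 , 10) ∷ (+ 4 , 2) ∷ (+ 5 , 5) ∷ [])) 2F 1))

    vertexD : SoleVertex 3F
    vertexD = soleVertex (from-yes (isolates? (table
      ((- + 1 , 1) ∷ (- + 2 , 1) ∷ (+ 3 , 2) ∷ (- + 4 , 10) ∷ (+ 5 , 5) ∷ [])) 3F 1))

    verticesE : ∃ λ x → ∃ λ y → τ x ≡ 4F × τ y ≡ 4F × x ≢ y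
    verticesE = filter-pair (λ x → τ x Fin.≟ 4F) (Unique.allFin⁺ (#V H))
      (count≡ 2 (from-yes (isolates? (table
        ((- + 1 , 2) ∷ (- + 2 , 2) ∷ (+ 3 , 4) ∷ (+ 4 , 4) ∷ (+ 5 , 10) ∷ [])) 4F 2)))

    edge5 : ∀ {x} → τ x ≡ 4F → ∃ λ y → τ y ≡ 5F × Joined 4 x y
    edge5 τx = joinTo (from-yes (occurs? (- + 5) 5F)) (∈tile τx (there (there (here refl))))

  vertexE₁ vertexE₂ vertexF₁ vertexF₂ : Fin (#V H)
  vertexE₁ = proj₁ verticesE
  vertexE₂ = proj₁ (proj₂ verticesE)

  τE₁ : τ vertexE₁ ≡ 4F
  τE₁ = proj₁ (proj₂ (proj₂ verticesE))

  τE₂ : τ vertexE₂ ≡ 4F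
  τE₂ = proj₁ (proj₂ (proj₂ (proj₂ verticesE)))

  E₁≢E₂ : vertexE₁ ≢ vertexE₂
  E₁≢E₂ = proj₂ (proj₂ (proj₂ (proj₂ verticesE)))

  vertexF₁ = proj₁ (edge5 τE₁)
  vertexF₂ = proj₁ (edge5 τE₂)

  τF₁ : τ vertexF₁ ≡ 5F
  τF₁ = proj₁ (proj₂ (edge5 τE₁))

  τF₂ : τ vertexF₂ ≡ 5F
  τF₂ = proj₁ (proj₂ (edge5 τE₂))

  -- The tile of type 5F contains - 5 only once.
  distinct-heads : ∀ {x x′ y y′} → Joined 4 x y → Joined 4 x′ y′ → τ y ≡ 5F → x ≢ x′ → y ≢ y′
  distinct-heads (i , refl , col≡) (i′ , refl , col′≡) τy x≢x′ y≡y′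
    with t , tile↭t ← incoming-twice {i} {i′} (x≢x′ ∘ cong tail) y≡y′ = contradiction
    (drop-∷ (↭-trans (↭-sym (shift (- + 5) (- + 1 ∷ - + 2 ∷ []) []))
      (↭-trans (↭-sym (subst (λ j → tile D col (head i) ↭ tileOf j) τy (tile↭ (head i))))
        (↭-trans tile↭t (↭-reflexive (cong₂ (λ i j → - i ∷ - j ∷ t) col≡ col′≡))))))
    (λ ↭t → case ∈-resp-↭ (↭-sym ↭t) (here refl) of λ { (here ()) ; (there (here ())) ; (there (there ())) })

  F₁≢F₂ : vertexF₁ ≢ vertexF₂
  F₁≢F₂ = distinct-heads (proj₂ (proj₂ (edge5 τE₁))) (proj₂ (proj₂ (edge5 τE₂))) τF₁ E₁≢E₂

  -- The non-adjacent pairs (A,C), (B,D), (E₁,F₂), (E₂,F₁) become the antipodal pairs.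
  φ : Vertex → Fin (#V H)
  φ = Vec.lookup (proj₁ vertexA ∷ vertexF₁ ∷ vertexF₂ ∷ proj₁ vertexB
                 ∷ proj₁ vertexD ∷ vertexE₁ ∷ vertexE₂ ∷ proj₁ vertexC ∷ [])

  φ-type : Vertex → TileType
  φ-type = Vec.lookup (0F ∷ 5F ∷ 5F ∷ 1F ∷ 3F ∷ 4F ∷ 4F ∷ 2F ∷ [])

  τ∘φ : ∀ x → τ (φ x) ≡ φ-type x
  τ∘φ 0F = proj₁ (proj₂ vertexA)
  τ∘φ 1F = τF₁
  τ∘φ 2F = τF₂
  τ∘φ 3F = proj₁ (proj₂ vertexB)
  τ∘φ 4F = proj₁ (proj₂ vertexD)
  τ∘φ 5F = τE₁
  τ∘φ 6F = τE₂
  τ∘φ 7F = proj₁ (proj₂ vertexC)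

  φ-type-separates : ∀ x y → φ-type x ≡ φ-type y → x ≡ y ⊎ (x , y) ∼ (1F , 2F) ⊎ (x , y) ∼ (5F , 6F)
  φ-type-separates = from-yes (Fin.all? λ x → Fin.all? λ y →
    (φ-type x Fin.≟ φ-type y) →-dec ((x Fin.≟ y) ⊎-dec ((x , y) ∼? (1F , 2F)) ⊎-dec ((x , y) ∼? (5F , 6F))))

  φ-injective : Injective _≡_ _≡_ φ
  φ-injective {x} {y} eq with φ-type-separates x y (trans (sym (τ∘φ x)) (trans (cong τ eq) (τ∘φ y)))
  ... | inj₁ x≡y                = x≡y
  ... | inj₂ (inj₁ (inj₁ refl)) = contradiction eq F₁≢F₂
  ... | inj₂ (inj₁ (inj₂ refl)) = contradiction (sym eq) F₁≢F₂
  ... | inj₂ (inj₂ (inj₁ refl)) = contradiction eq E₁≢E₂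
  ... | inj₂ (inj₂ (inj₂ refl)) = contradiction (sym eq) E₁≢E₂

  -- Color 1 leaves only tiles of type `0F`, and a single vertex has that type. The next three
  -- lemmas use the same argument.
  fromA : ∀ {y} → - + 1 ∈ tile D col y → Joined 0 (proj₁ vertexA) y
  fromA i∈ with x , τx , joined ← joinFrom (from-yes (occurs? (+ 1) 0F)) i∈ =
    subst (λ x → Joined 0 x _) (proj₂ (proj₂ vertexA) τx) joined

  fromB : ∀ {y} → - + 2 ∈ tile D col y → Joined 1 (proj₁ vertexB) y
  fromB i∈ with x , τx , joined ← joinFrom (from-yes (occurs? (+ 2) 1F)) i∈ =
    subst (λ x → Joined 1 x _) (proj₂ (proj₂ vertexB) τx) joined

  toC : ∀ {x} → + 3 ∈ tile D col x → Joined 2 x (proj₁ vertexC)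
  toC i∈ with y , τy , joined ← joinTo (from-yes (occurs? (- + 3) 2F)) i∈ =
    subst (Joined 2 _) (proj₂ (proj₂ vertexC) τy) joined

  toD : ∀ {x} → + 4 ∈ tile D col x → Joined 3 x (proj₁ vertexD)
  toD i∈ with y , τy , joined ← joinTo (from-yes (occurs? (- + 4) 3F)) i∈ =
    subst (Joined 3 _) (proj₂ (proj₂ vertexD) τy) joined

  edgeColor : Edge → ℕ
  edgeColor = Vec.lookup (0 ∷ 0 ∷ 0 ∷ 1 ∷ 4 ∷ 1 ∷ 4 ∷ 1 ∷ 3 ∷ 3 ∷ 2 ∷ 2 ∷ [])

  -- Each edge is found from the half-edge that determines its other end: at the head for colors 1
  -- and 2, at the tail for colors 3, 4 and 5.
  joined : ∀ e → Joined (edgeColor e) (φ (evenEnd e)) (φ (oddEnd e))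
  joined 0F  = fromA (∈tile τF₁ (here refl))
  joined 1F  = fromA (∈tile τF₂ (here refl))
  joined 2F  = fromA (∈tile (proj₁ (proj₂ vertexD)) (here refl))
  joined 3F  = fromB (∈tile τF₁ (there (here refl)))
  joined 4F  = proj₂ (proj₂ (edge5 τE₁))
  joined 5F  = fromB (∈tile τF₂ (there (here refl)))
  joined 6F  = proj₂ (proj₂ (edge5 τE₂))
  joined 7F  = fromB (∈tile (proj₁ (proj₂ vertexC)) (here refl))
  joined 8F  = toD (∈tile τE₁ (there (here refl)))
  joined 9F  = toD (∈tile τE₂ (there (here refl)))
  joined 10F = toC (∈tile τE₁ (here refl))
  joined 11F = toC (∈tile τE₂ (here refl))

  ψ : Edge → Fin (#E H)
  ψ e = proj₁ (joined e)

  φψ : ∀ e → ends H (ψ e) ∼ Product.map φ φ (ends cube e)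
  φψ e = ∼-trans (∼-sym (orients (ψ e)))
    (∼-trans (inj₁ (proj₁ (proj₂ (joined e)))) (∼-map φ (∼-sym (ends-cube e))))

  E≡12 : #E H ≡ 12
  E≡12 = ℕ.*-cancelʳ-≡ _ _ 2 (trans (sym (cubic⇒3V≡2E λ x → trans (↭-length (tile↭ x)) (lengths (τ x))))
                                   (cong (ℕ._* 3) V≡8))
    where
    lengths : ∀ j → length (tileOf j) ≡ 3
    lengths = from-yes (Fin.all? λ j → length (tileOf j) ℕ.≟ 3)

  ≃cube : H ≃ cube
  ≃cube = embedding⇒≃ φ ψ φ-injective φψ cube-simple H≤8 (ℕ.≤-reflexive E≡12)

-- `P₂` as a witness for six tiles and five colors

cube∈𝒪P₂ : cube ∈𝒪 P₂
cube∈𝒪P₂ = D , 5 , col , λ t (x , t↭) → Pot.resp P₂ (↭-sym t↭) (tiles∈P₂ x)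
  where
  D : Orientation cube
  D = record { arc = λ e → evenEnd e , oddEnd e ; orients = λ e → ∼-sym (ends-cube e) }
  col : Coloring cube 5
  -- This is `coloring₂ 0F 3F`, shifted down by one because `Fin 5` stands for the colors 1 to 5.
  col = Vec.lookup (0F ∷ 0F ∷ 0F ∷ 1F ∷ 4F ∷ 1F ∷ 4F ∷ 1F ∷ 3F ∷ 3F ∷ 2F ∷ 2F ∷ [])
  tiles∈P₂ : ∀ x → P₂ ∋ tile D col x
  tiles∈P₂ = from-yes (Fin.all? λ x → Any.any? (tile D col x ↭?_) tiles₂)

P₂-3-realizes-cube : P₂ 3-realizes cube
P₂-3-realizes-cube = cube∈𝒪P₂ , λ (H , (D , _ , col , ⊆P₂) , ≄cube , H≤8) →
  ≄cube (SmallGraph.≃cube D col ⊆P₂ H≤8)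

∣P₂∣≡6 : ∣ P₂ ∣≡ 6
∣P₂∣≡6 = tiles₂ , from-yes (AllPairs.allPairs? (λ t u → ¬? (t ↭? u)) tiles₂) , refl , λ _ → mk⇔ id id

∣ΣP₂∣≡5 : ∣Σ P₂ ∣≡ 5
∣ΣP₂∣≡5 = colors , from-yes (AllPairs.allPairs? (λ i j → ¬? (i ℤ.≟ j)) colors) , refl , λ i → mk⇔ (to i) from
  where
  colors : List ℤ
  colors = + 1 ∷ + 2 ∷ + 3 ∷ + 4 ∷ + 5 ∷ []

  positive : All (λ t → All (λ i → 0ℤ ℤ.< i → i ∈ colors) t) tiles₂
  positive = from-yes (All.all? (All.all? λ i → (0ℤ ℤ.<? i) →-dec Any.any? (i ℤ.≟_) colors) tiles₂)

  occur : All (λ i → 0ℤ ℤ.< i × Any (i ∈_) tiles₂) colors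
  occur = from-yes (All.all? (λ i → (0ℤ ℤ.<? i) ×-dec Any.any? (Any.any? (i ℤ.≟_)) tiles₂) colors)

  to : ∀ i → Colors P₂ i → i ∈ colors
  to i (0<i , t , t∈P₂ , i∈t) with u , u∈ , t↭u ← find t∈P₂ =
    All.lookup (All.lookup positive u∈) (∈-resp-↭ t↭u i∈t) 0<i

  from : ∀ {i} → i ∈ colors → Colors P₂ i
  from i∈ with 0<i , i∈ts ← All.lookup occur i∈ with t , t∈ , i∈t ← find i∈ts =
    0<i , t , lose t∈ ↭-refl , i∈t

theorem2 : ∀ (P : Pot) → Biminimal cube P → (P ≅ P₁) ⊎ (P ≅ P₂)
theorem2 P biminimal with size-T₃ | colors-B₃
  where open Biminimal biminimal
... | k , (_ , k-least) , ∣P∣≡k | j , (_ , j-least) , ∣ΣP∣≡j =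
  fewSizes⇒≅ (3-realizes⇒labelling (Biminimal.realizes biminimal))
    ∣P∣≡k (k-least 6 (P₂ , P₂-3-realizes-cube , ∣P₂∣≡6))
    ∣ΣP∣≡j (j-least 5 (P₂ , P₂-3-realizes-cube , ∣ΣP₂∣≡5))
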